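{- $\tfrac32\le C^*\le 6.614$.
   Context: Every Boolean function $f:\{0,1\}^n\to\{0,1\}$ has a unique multilinear representation over $\mathbb{R}$, $f(x)=\sum_{S\subseteq[n]}a_S\prod_{i\in S}x_i$; $\deg(f)$ is the maximum $|S|$ with $a_S\ne0$. A variable $x_i$ is relevant if it appears in a monomial with nonzero coefficient; $R(f)$ is the number of relevant variables. $R_d$ is the maximum of $R(f)$ over Boolean functions of degree at most $d$, $C_d=R_d2^{ -d}$, and $C^*=\lim_{d\to\infty}C_d$ (the sequence $C_d$ is nondecreasing). -}

module Defs where

open import Data.Bool using (Bool; true; false; if_then_else_)
open import Data.Nat using (ℕ; zero; suc; _<_)
open import Data.Fin using (Fin)
open import Data.Vec using (Vec; []; _∷_; lookup)
open import Data.List using (List; [_]; map; _++_; foldr; length; filter)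
open import Data.List.Relation.Unary.Any using (Any)
open import Data.Integer using (ℤ; _+_; _*_; 0ℤ; 1ℤ)
open import Data.Product using (_×_)
open import Relation.Binary.PropositionalEquality using (_≡_; _≢_)

-- All points of {0,1}^n (true = 1), equivalently all subsets S ⊆ [n]
-- encoded by their characteristic vectors.
allVecs : (n : ℕ) → List (Vec Bool n)
allVecs zero = [ [] ]
allVecs (suc n) = map (false ∷_) (allVecs n) ++ map (true ∷_) (allVecs n)

BoolFun : ℕ → Set
BoolFun n = Vec Bool n → Bool

-- Real-valued (here integer-valued suffices for the 0/1 output) reading.
toℤ : Bool → ℤ
toℤ true = 1ℤ
toℤ false = 0ℤ

size : {n : ℕ} → Vec Bool n → ℕ
size [] = zero
size (true ∷ S) = suc (size S)
size (false ∷ S) = size S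

monomial : {n : ℕ} → Vec Bool n → Vec Bool n → ℤ
monomial [] [] = 1ℤ
monomial (false ∷ S) (_ ∷ x) = monomial S x
monomial (true ∷ S) (b ∷ x) = toℤ b * monomial S x

sumℤ : List ℤ → ℤ
sumℤ = foldr _+_ 0ℤ

Coeffs : ℕ → Set
Coeffs n = Vec Bool n → ℤ

evalPoly : {n : ℕ} → Coeffs n → Vec Bool n → ℤ
evalPoly {n} a x = sumℤ (map (λ S → a S * monomial S x) (allVecs n))

-- a is the multilinear representation of f: f(x) = Σ_S a_S ∏_{i∈S} x_i
-- for all x ∈ {0,1}^n.  (The representation is unique, and since f is
-- 0/1-valued the coefficients are integers.)
Represents : {n : ℕ} → BoolFun n → Coeffs n → Set
Represents {n} f a = (x : Vec Bool n) → evalPoly a x ≡ toℤ (f x)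

DegreeAtMost : {n : ℕ} → Coeffs n → ℕ → Set
DegreeAtMost a d = ∀ S → d < size S → a S ≡ 0ℤ

Relevant : {n : ℕ} → Coeffs n → Fin n → Set
Relevant {n} a i = Any (λ S → (lookup S i ≡ true) × (a S ≢ 0ℤ)) (allVecs n)

open import Data.List using (allFin)
open import Data.Bool.Properties using () renaming (_≟_ to _≟ᵇ_)
import Data.Integer.Properties as ℤP
open import Relation.Nullary using (¬?)
open import Relation.Nullary.Decidable using (_×-dec_)
open import Relation.Unary using (Decidable)
import Data.List.Relation.Unary.Any as Any

relevant? : {n : ℕ} → (a : Coeffs n) → Decidable (Relevant a)
relevant? {n} a i =
  Any.any? (λ S → (lookup S i ≟ᵇ true) ×-dec ¬? (a S ℤP.≟ 0ℤ)) (allVecs n)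

numRelevant : {n : ℕ} → Coeffs n → ℕ
numRelevant {n} a = length (filter (relevant? a) (allFin n))

-- Upper bound.  Give a relevant variable xᵢ the weight 2^(−degᵢ), where degᵢ is the largest degree of a monomial
-- containing xᵢ; a function of degree at most d and total weight W has at most 2^d W relevant variables.
-- * W ≤ d / 2, because a variable of weight w has influence at least 2 w and the total influence is at most d.
-- * A maximal disjoint family of monomials of degree d hits all of them, and its d k variables weigh 2^(−d) each.
--   Fixing them lowers the degree and does not decrease the average weight of the others, so with k ≤ d² the
--   bound on the weight grows by at most d³ 2^(−d) from degree d − 1 to degree d.
-- * k ≤ d²: inside each of the k monomials there is a block whose flip changes f(0).  Flipping every block
--   independently with probability t gives a mean value q(t) that is a polynomial of degree at most d, stays in
--   [0, 1] for t in [0, 1], and has slope ± k at 0.  This is Markov's inequality; only k ≤ 4 d² is proved directly,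
--   by interpolating at the rational nodes j² / d², and the constant is removed by iterating q.
-- The first bound up to degree 11 and the second from 12 on give 11 / 2 + Σ_{i > 11} i³ 2^(−i) < 6.614.
-- Lower bound.  Two new variables select between f and its negation on two disjoint copies of the variables in such
-- a way that the degree grows by one: n variables become 2 n + 2, so degree d is reached with 3 · 2^(d−1) − 2.
module Submission where

open import Defs

-- Polynomials in one variable over ℚ, and Markov's inequality up to a constant factor.

module RationalPolynomials where

  open import Data.Nat as ℕ using (ℕ; zero; suc; _∸_; _!)
  import Data.Nat.DivMod as ℕD
  import Data.Nat.Properties as ℕP
  open import Data.Nat.Combinatorics
    using (_C_; nCk≡n!/k![n-k]!; nCk≡nC[n∸k]; nCk+nC[k+1]≡[n+1]C[k+1]; nCn≡1; k![n∸k]!∣n!)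
  open import Data.Nat.Combinatorics.Specification using (k>n⇒nCk≡0)
  open import Data.Rational
  open import Data.Rational.Properties
  open import Data.Product using (Σ; _,_; _×_; proj₁; proj₂)
  open import Data.Sum using (_⊎_; inj₁; inj₂)
  open import Level using (0ℓ)
  open import Relation.Binary.PropositionalEquality
  open import Relation.Nullary.Decidable using (dec⇒maybe)
  open import Tactic.RingSolver using (solve-∀)
  open import Tactic.RingSolver.Core.AlmostCommutativeRing using (AlmostCommutativeRing; fromCommutativeRing)

  ℚ-ring : AlmostCommutativeRing 0ℓ 0ℓ
  ℚ-ring = fromCommutativeRing +-*-commutativeRing (λ x → dec⇒maybe (0ℚ ≟ x))

  0≤+ : ∀ {p q} → 0ℚ ≤ p → 0ℚ ≤ q → 0ℚ ≤ p + q
  0≤+ p≥0 q≥0 = +-mono-≤ p≥0 q≥0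

  0≤* : ∀ {p q} → 0ℚ ≤ p → 0ℚ ≤ q → 0ℚ ≤ p * q
  0≤* {p} {q} p≥0 q≥0 = subst (_≤ p * q) (*-zeroʳ p) (*-monoˡ-≤-nonNeg p {{nonNegative p≥0}} q≥0)

  0≤-⇒≤ : ∀ {p q} → 0ℚ ≤ q - p → p ≤ q
  0≤-⇒≤ {p} {q} h = subst₂ _≤_ (+-identityˡ p) (lem q p) (+-monoˡ-≤ p h)
    where
    lem : ∀ q p → q - p + p ≡ q
    lem = solve-∀ ℚ-ring

  ≤⇒0≤- : ∀ {p q} → p ≤ q → 0ℚ ≤ q - p
  ≤⇒0≤- {p} {q} h = subst (_≤ q - p) (+-inverseʳ p) (+-monoˡ-≤ (- p) h)

  *-monoˡ-≤ : ∀ {r p q} → 0ℚ ≤ r → p ≤ q → r * p ≤ r * q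
  *-monoˡ-≤ {r} h = *-monoˡ-≤-nonNeg r {{nonNegative h}}

  0≤1 : 0ℚ ≤ 1ℚ
  0≤1 = nonNegative⁻¹ 1ℚ

  ι : ℕ → ℚ
  ι zero = 0ℚ
  ι (suc n) = 1ℚ + ι n

  0≤ι : ∀ n → 0ℚ ≤ ι n
  0≤ι zero = ≤-refl
  0≤ι (suc n) = 0≤+ 0≤1 (0≤ι n)

  ι-+ : ∀ m n → ι (m ℕ.+ n) ≡ ι m + ι n
  ι-+ zero n = sym (+-identityˡ (ι n))
  ι-+ (suc m) n = trans (cong (1ℚ +_) (ι-+ m n)) (sym (+-assoc 1ℚ (ι m) (ι n)))

  ι-* : ∀ m n → ι (m ℕ.* n) ≡ ι m * ι n
  ι-* zero n = sym (*-zeroˡ (ι n))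
  ι-* (suc m) n = trans (ι-+ n (m ℕ.* n)) (trans (cong (ι n +_) (ι-* m n)) (lem (ι n) (ι m)))
    where
    lem : ∀ n m → n + m * n ≡ (1ℚ + m) * n
    lem = solve-∀ ℚ-ring

  ι-mono : ∀ {m n} → m ℕ.≤ n → ι m ≤ ι n
  ι-mono {n = n} ℕ.z≤n = 0≤ι n
  ι-mono (ℕ.s≤s h) = +-monoʳ-≤ 1ℚ (ι-mono h)

  ι-suc>0 : ∀ n → 0ℚ < ι (suc n)
  ι-suc>0 n = <-≤-trans (positive⁻¹ 1ℚ) (subst (_≤ ι (suc n)) (+-identityʳ 1ℚ) (+-monoʳ-≤ 1ℚ (0≤ι n)))

  ι-cancel-≤ : ∀ {m n} → ι m ≤ ι n → m ℕ.≤ n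
  ι-cancel-≤ {zero} h = ℕ.z≤n
  ι-cancel-≤ {suc m} {zero} h with () ← <-irrefl refl (<-≤-trans (ι-suc>0 m) h)
  ι-cancel-≤ {suc m} {suc n} h = ℕ.s≤s (ι-cancel-≤ (0≤-⇒≤ (subst (0ℚ ≤_) (lem (ι n) (ι m)) (≤⇒0≤- h))))
    where
    lem : ∀ n m → (1ℚ + n) - (1ℚ + m) ≡ n - m
    lem = solve-∀ ℚ-ring

  inv : ℕ → ℚ
  inv n = (1/ ι (suc n)) {{≢-nonZero (λ e → <⇒≢ (ι-suc>0 n) (sym e))}}

  inv-inverse : ∀ n → ι (suc n) * inv n ≡ 1ℚ
  inv-inverse n = *-inverseʳ (ι (suc n)) {{≢-nonZero (λ e → <⇒≢ (ι-suc>0 n) (sym e))}}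

  0<inv : ∀ n → 0ℚ < inv n
  0<inv n = positive⁻¹ (inv n) {{1/pos⇒pos (ι (suc n)) {{positive (ι-suc>0 n)}}}}

  -- Horner form. The equations are pointwise, so that membership respects pointwise equality of
  -- functions, and d only bounds the degree.
  data Poly : ℕ → (ℚ → ℚ) → Set where
    const : ∀ {d q} c → (∀ x → q x ≡ c) → Poly d q
    step  : ∀ {d q p} c → Poly d p → (∀ x → q x ≡ c + x * p x) → Poly (suc d) q

  poly-≗ : ∀ {d p q} → p ≗ q → Poly d q → Poly d p
  poly-≗ e (const c h) = const c (λ x → trans (e x) (h x))
  poly-≗ e (step c P h) = step c P (λ x → trans (e x) (h x))

  poly-weaken : ∀ {m n q} → m ℕ.≤ n → Poly m q → Poly n q
  poly-weaken le (const c h) = const c h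
  poly-weaken (ℕ.s≤s le) (step c P h) = step c (poly-weaken le P) h

  poly-x : ∀ {d p} → Poly d p → Poly (suc d) (λ x → x * p x)
  poly-x P = step 0ℚ P (λ x → sym (+-identityˡ _))

  poly-+ : ∀ {d p q} → Poly d p → Poly d q → Poly d (λ x → p x + q x)
  poly-+ (const c h) (const c′ h′) = const (c + c′) (λ x → cong₂ _+_ (h x) (h′ x))
  poly-+ {p = p} {q} (const c h) (step {p = q′} c′ P h′) =
    step (c + c′) P (λ x → trans (cong₂ _+_ (h x) (h′ x)) (sym (+-assoc c c′ _)))
  poly-+ (step {p = p′} c P h) (const c′ h′) =
    step (c + c′) P (λ x → trans (cong₂ _+_ (h x) (h′ x)) (lem c (x * p′ x) c′))
    where
    lem : ∀ c y c′ → c + y + c′ ≡ c + c′ + y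
    lem = solve-∀ ℚ-ring
  poly-+ (step {p = p′} c P h) (step {p = q′} c′ Q h′) =
    step (c + c′) (poly-+ P Q) (λ x → trans (cong₂ _+_ (h x) (h′ x)) (lem c c′ x (p′ x) (q′ x)))
    where
    lem : ∀ c c′ x y z → c + x * y + (c′ + x * z) ≡ c + c′ + x * (y + z)
    lem = solve-∀ ℚ-ring

  poly-scale : ∀ {d q} k → Poly d q → Poly d (λ x → k * q x)
  poly-scale k (const c h) = const (k * c) (λ x → cong (k *_) (h x))
  poly-scale k (step {p = p′} c P h) =
    step (k * c) (poly-scale k P) (λ x → trans (cong (k *_) (h x)) (lem k c x (p′ x)))
    where
    lem : ∀ k c x y → k * (c + x * y) ≡ k * c + x * (k * y)
    lem = solve-∀ ℚ-ring

  poly-* : ∀ {m n p q} → Poly m p → Poly n q → Poly (m ℕ.+ n) (λ x → p x * q x)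
  poly-* {m} {n} {q = q} (const c h) Q =
    poly-≗ (λ x → cong (_* q x) (h x)) (poly-weaken (ℕP.m≤n+m n m) (poly-scale c Q))
  poly-* {suc m} {n} {q = q} (step {p = p′} c P h) Q =
    poly-≗ (λ x → trans (cong (_* q x) (h x)) (lem c x (p′ x) (q x)))
      (poly-+ (poly-weaken (ℕP.m≤n+m n (suc m)) (poly-scale c Q)) (poly-x (poly-* P Q)))
    where
    lem : ∀ c x y z → (c + x * y) * z ≡ c * z + x * (y * z)
    lem = solve-∀ ℚ-ring

  poly-∘ : ∀ {m n p q} → Poly m p → Poly n q → Poly (m ℕ.* n) (λ x → p (q x))
  poly-∘ {q = q} (const c h) Q = const c (λ x → h (q x))
  poly-∘ {q = q} (step c P h) Q =
    poly-≗ (λ x → h (q x)) (poly-+ (const c (λ _ → refl)) (poly-* Q (poly-∘ P Q)))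

  poly-id : Poly 1 (λ x → x)
  poly-id = step 0ℚ (const {0} 1ℚ (λ _ → refl)) (λ x → lem x)
    where
    lem : ∀ x → x ≡ 0ℚ + x * 1ℚ
    lem = solve-∀ ℚ-ring

  poly-shift : ∀ {d q} k → Poly d q → Poly d (λ x → q (x + k))
  poly-shift {d} k P = subst (λ m → Poly m _) (ℕP.*-identityʳ d)
    (poly-∘ P (poly-+ poly-id (const k (λ _ → refl))))

  -- For q = c + x p the difference is x (p(x) - p(x + 1)) - p(x + 1), and both summands respect the
  -- smaller bound by induction.
  poly-Δ : ∀ {d q} → Poly (suc d) q → Poly d (λ x → q x - q (x + 1ℚ))
  poly-Δ (const c h) = const 0ℚ (λ x → trans (cong₂ _-_ (h x) (h (x + 1ℚ))) (+-inverseʳ c))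
  poly-Δ {zero} (step {p = p} c (const c′ h′) h) = const (- c′) λ x →
    trans (cong₂ _-_ (trans (h x) (cong (λ y → c + x * y) (h′ x)))
                     (trans (h (x + 1ℚ)) (cong (λ y → c + (x + 1ℚ) * y) (h′ (x + 1ℚ))))) (lem c x c′)
    where
    lem : ∀ c x y → c + x * y - (c + (x + 1ℚ) * y) ≡ - y
    lem = solve-∀ ℚ-ring
  poly-Δ {suc d} (step {p = p} c P h) = poly-≗
    (λ x → trans (cong₂ _-_ (h x) (h (x + 1ℚ))) (lem c x (p x) (p (x + 1ℚ))))
    (poly-+ (poly-x (poly-Δ P)) (poly-scale (- 1ℚ) (poly-shift 1ℚ P)))
    where
    lem : ∀ c x y z → c + x * y - (c + (x + 1ℚ) * z) ≡ x * (y - z) + - 1ℚ * z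
    lem = solve-∀ ℚ-ring

  poly-÷x : ∀ {d q} → Poly (suc d) q → q 0ℚ ≡ 0ℚ → Σ (ℚ → ℚ) λ r → Poly d r × (∀ x → q x ≡ x * r x)
  poly-÷x (const c h) q0 = (λ _ → 0ℚ) , const 0ℚ (λ _ → refl) ,
    λ x → trans (h x) (trans (trans (sym (h 0ℚ)) q0) (sym (*-zeroʳ x)))
  poly-÷x (step {p = p} c P h) q0 = p , P , λ x → trans (h x) (trans (cong (_+ x * p x) c≡0) (+-identityˡ _))
    where
    lem : ∀ c y → c ≡ c + 0ℚ * y
    lem = solve-∀ ℚ-ring
    c≡0 : c ≡ 0ℚ
    c≡0 = trans (lem c (p 0ℚ)) (trans (sym (h 0ℚ)) q0)

  -- Iterated finite differences at 0 and alternating binomial sums.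

  alt : ℕ → (ℕ → ℚ) → ℚ
  alt zero h = h 0
  alt (suc n) h = alt n (λ i → h i - h (suc i))

  alt-cong : ∀ n {g h} → g ≗ h → alt n g ≡ alt n h
  alt-cong zero e = e 0
  alt-cong (suc n) e = alt-cong n (λ i → cong₂ _-_ (e i) (e (suc i)))

  alt-0 : ∀ n {h} → (∀ i → h i ≡ 0ℚ) → alt n h ≡ 0ℚ
  alt-0 zero e = e 0
  alt-0 (suc n) e = alt-0 n (λ i → cong₂ _-_ (e i) (e (suc i)))

  -- Each difference lowers the degree until the function is constant, and the difference after that
  -- is zero.
  alt-vanish : ∀ {d n q} → d ℕ.< n → Poly d q → alt n (λ i → q (ι i)) ≡ 0ℚ
  alt-vanish {zero} {suc n} _ (const c h) = alt-0 n (λ i → trans (cong₂ _-_ (h (ι i)) (h (ι (suc i)))) (+-inverseʳ c))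
  alt-vanish {suc d} {suc n} {q} (ℕ.s≤s lt) P =
    trans (alt-cong n (λ i → cong (λ y → q (ι i) - q y) (+-comm 1ℚ (ι i)))) (alt-vanish lt (poly-Δ P))

  alt-head : ∀ n {h} → (∀ i → h (suc i) ≡ 0ℚ) → alt n h ≡ h 0
  alt-head zero e = refl
  alt-head (suc n) {h} e = trans (alt-head n (λ i → cong₂ _-_ (e i) (e (suc i))))
    (trans (cong (λ y → h 0 - y) (e 0)) (+-identityʳ (h 0)))

  -- A difference of order d + 1 vanishes, and it reduces to the value at 0 when all positive nodes
  -- contribute nothing. This serves to compare two quotients by x at 0, where x cannot be
  -- cancelled.
  poly-0-at-0 : ∀ {d q} → Poly d q → (∀ i → q (ι (suc i)) ≡ 0ℚ) → q 0ℚ ≡ 0ℚ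
  poly-0-at-0 {d} {q} P e = trans (sym (alt-head (suc d) {λ i → q (ι i)} e)) (alt-vanish (ℕP.n<1+n d) P)

  ∑ : ℕ → (ℕ → ℚ) → ℚ
  ∑ zero f = 0ℚ
  ∑ (suc n) f = f 0 + ∑ n (λ i → f (suc i))

  ∑-cong : ∀ n {f g} → f ≗ g → ∑ n f ≡ ∑ n g
  ∑-cong zero e = refl
  ∑-cong (suc n) e = cong₂ _+_ (e 0) (∑-cong n (λ i → e (suc i)))

  ∑-scale : ∀ n k f → ∑ n (λ i → k * f i) ≡ k * ∑ n f
  ∑-scale zero k f = sym (*-zeroʳ k)
  ∑-scale (suc n) k f = trans (cong (k * f 0 +_) (∑-scale n k (λ i → f (suc i)))) (sym (*-distribˡ-+ k _ _))

  ∑-sub : ∀ n f g → ∑ n (λ i → f i - g i) ≡ ∑ n f - ∑ n g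
  ∑-sub zero f g = refl
  ∑-sub (suc n) f g = trans (cong (f 0 - g 0 +_) (∑-sub n (λ i → f (suc i)) (λ i → g (suc i)))) (lem (f 0) (g 0) _ _)
    where
    lem : ∀ a b c d → a - b + (c - d) ≡ a + c - (b + d)
    lem = solve-∀ ℚ-ring

  ∑-split : ∀ m n f → ∑ (m ℕ.+ n) f ≡ ∑ m f + ∑ n (λ i → f (m ℕ.+ i))
  ∑-split zero n f = sym (+-identityˡ _)
  ∑-split (suc m) n f = trans (cong (f 0 +_) (∑-split m n (λ i → f (suc i)))) (sym (+-assoc (f 0) _ _))

  ∑-last : ∀ n f → ∑ (suc n) f ≡ ∑ n f + f n
  ∑-last zero f = +-comm (f 0) 0ℚ
  ∑-last (suc n) f = trans (cong (f 0 +_) (∑-last n (λ i → f (suc i)))) (sym (+-assoc (f 0) _ _))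

  ∑-telescope : ∀ n (u : ℕ → ℚ) → ∑ n (λ i → u i - u (suc i)) ≡ u 0 - u n
  ∑-telescope zero u = sym (+-inverseʳ (u 0))
  ∑-telescope (suc n) u = trans (cong (u 0 - u 1 +_) (∑-telescope n (λ i → u (suc i)))) (lem (u 0) (u 1) (u (suc n)))
    where
    lem : ∀ a b c → a - b + (b - c) ≡ a - c
    lem = solve-∀ ℚ-ring

  ∑-reverse : ∀ n f → ∑ n (λ i → f (n ∸ suc i)) ≡ ∑ n f
  ∑-reverse zero f = refl
  ∑-reverse (suc n) f = trans (cong (f n +_) (∑-reverse n f)) (trans (+-comm (f n) _) (sym (∑-last n f)))

  sign : ℕ → ℚ
  sign zero = 1ℚ
  sign (suc n) = - sign n

  alt-binomial : ∀ n h → alt n h ≡ ∑ (suc n) (λ i → sign i * ι (n C i) * h i)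
  alt-binomial zero h = lem (h 0)
    where
    lem : ∀ x → x ≡ 1ℚ * (1ℚ + 0ℚ) * x + 0ℚ
    lem = solve-∀ ℚ-ring
  alt-binomial (suc n) h = begin
    alt n (λ i → h i - h (suc i))
      ≡⟨ alt-binomial n _ ⟩
    ∑ (suc n) (λ i → sign i * ι (n C i) * (h i - h (suc i)))
      ≡⟨ ∑-cong (suc n) (λ i → lem₁ (sign i * ι (n C i)) (h i) (h (suc i))) ⟩
    ∑ (suc n) (λ i → t i - u i)
      ≡⟨ ∑-sub (suc n) t u ⟩
    ∑ (suc n) t - ∑ (suc n) u
      ≡⟨ cong (_- ∑ (suc n) u) extend ⟩
    t 0 + ∑ (suc n) (λ i → t (suc i)) - ∑ (suc n) u
      ≡⟨ lem₂ (t 0) (∑ (suc n) (λ i → t (suc i))) (∑ (suc n) u) ⟩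
    t 0 + (∑ (suc n) (λ i → t (suc i)) - ∑ (suc n) u)
      ≡⟨ cong (t 0 +_) (sym (∑-sub (suc n) (λ i → t (suc i)) u)) ⟩
    t 0 + ∑ (suc n) (λ i → t (suc i) - u i)
      ≡⟨ cong₂ _+_ head (∑-cong (suc n) pascal) ⟩
    ∑ (suc (suc n)) (λ i → sign i * ι (suc n C i) * h i) ∎
    where
    open ≡-Reasoning
    t : ℕ → ℚ
    t i = sign i * ι (n C i) * h i
    u : ℕ → ℚ
    u i = sign i * ι (n C i) * h (suc i)
    lem₁ : ∀ s x y → s * (x - y) ≡ s * x - s * y
    lem₁ = solve-∀ ℚ-ring
    lem₂ : ∀ x y z → x + y - z ≡ x + (y - z)
    lem₂ = solve-∀ ℚ-ring
    lem₃ : ∀ s a b x → (- s) * b * x - s * a * x ≡ (- s) * (a + b) * x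
    lem₃ = solve-∀ ℚ-ring
    lem₄ : ∀ s x y → x + s * 0ℚ * y ≡ x
    lem₄ = solve-∀ ℚ-ring
    -- The added last term carries C(n, n + 1) = 0. With it, splitting off the first term leaves a
    -- sum that matches the one of `u` index by index.
    extend : ∑ (suc n) t ≡ ∑ (suc (suc n)) t
    extend = sym (trans (∑-last (suc n) t)
      (trans (cong (λ k → ∑ (suc n) t + sign (suc n) * ι k * h (suc n)) (k>n⇒nCk≡0 (ℕP.n<1+n n)))
             (lem₄ (sign (suc n)) _ (h (suc n)))))
    head : t 0 ≡ 1ℚ * ι (suc n C 0) * h 0
    head = cong (λ k → 1ℚ * ι k * h 0) (trans (nC0 n) (sym (nC0 (suc n))))
      where
      nC0 : ∀ n → n C 0 ≡ 1
      nC0 n = trans (nCk≡nC[n∸k] {k = 0} {n = n} ℕ.z≤n) (nCn≡1 n)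
    pascal : ∀ i → t (suc i) - u i ≡ sign (suc i) * ι (suc n C suc i) * h (suc i)
    pascal i = trans (lem₃ (sign i) (ι (n C i)) (ι (n C suc i)) (h (suc i)))
      (cong (λ k → sign (suc i) * k * h (suc i))
        (trans (sym (ι-+ (n C i) (n C suc i))) (cong ι (nCk+nC[k+1]≡[n+1]C[k+1] n i))))

  -- The central binomial coefficient is the largest.

  nCk*k![n-k]! : ∀ {n k} → k ℕ.≤ n → (n C k) ℕ.* (k ! ℕ.* (n ∸ k) !) ≡ n !
  nCk*k![n-k]! {n} {k} k≤n = trans (cong (ℕ._* (k ! ℕ.* (n ∸ k) !)) (nCk≡n!/k![n-k]! k≤n))
    (ℕD.m/n*n≡m {{ℕP.m*n≢0 (k !) ((n ∸ k) !) {{k ℕP.!≢0}} {{(n ∸ k) ℕP.!≢0}}}} (k![n∸k]!∣n! k≤n))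

  -- After removing `m !` and `p !`, j factors remain on each side, and m + i ≤ p + i compares them
  -- one by one.
  !-log-convex : ∀ {m p} j → m ℕ.≤ p → (j ℕ.+ m) ! ℕ.* p ! ℕ.≤ m ! ℕ.* (j ℕ.+ p) !
  !-log-convex zero m≤p = ℕP.≤-refl
  !-log-convex {m} {p} (suc j) m≤p = begin
    suc (j ℕ.+ m) ℕ.* (j ℕ.+ m) ! ℕ.* p !       ≡⟨ ℕP.*-assoc (suc (j ℕ.+ m)) ((j ℕ.+ m) !) (p !) ⟩
    suc (j ℕ.+ m) ℕ.* ((j ℕ.+ m) ! ℕ.* p !)     ≤⟨ ℕP.*-mono-≤ (ℕ.s≤s (ℕP.+-monoʳ-≤ j m≤p)) (!-log-convex j m≤p) ⟩
    suc (j ℕ.+ p) ℕ.* (m ! ℕ.* (j ℕ.+ p) !)     ≡⟨ ℕP.*-comm (suc (j ℕ.+ p)) (m ! ℕ.* (j ℕ.+ p) !) ⟩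
    m ! ℕ.* (j ℕ.+ p) ! ℕ.* suc (j ℕ.+ p)       ≡⟨ ℕP.*-assoc (m !) ((j ℕ.+ p) !) (suc (j ℕ.+ p)) ⟩
    m ! ℕ.* ((j ℕ.+ p) ! ℕ.* suc (j ℕ.+ p))     ≡⟨ cong (m ! ℕ.*_) (ℕP.*-comm ((j ℕ.+ p) !) (suc (j ℕ.+ p))) ⟩
    m ! ℕ.* (suc (j ℕ.+ p) !) ∎
    where open ℕP.≤-Reasoning

  -- Log-convexity with the smaller of k and 2n - k as m, with p = n, and with j the distance from k
  -- to n.
  !-central : ∀ n k → k ℕ.≤ n ℕ.+ n → n ! ℕ.* n ! ℕ.≤ k ! ℕ.* (n ℕ.+ n ∸ k) !
  !-central n k k≤2n with ℕP.≤-total k n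
  ... | inj₁ k≤n = subst₂ (λ u v → u ! ℕ.* n ! ℕ.≤ k ! ℕ.* v !)
          (ℕP.m∸n+n≡m k≤n) (sym (trans (ℕP.+-∸-comm n k≤n) refl)) (!-log-convex (n ∸ k) k≤n)
  ... | inj₂ n≤k = subst₂ ℕ._≤_ refl (ℕP.*-comm ((n ℕ.+ n ∸ k) !) (k !))
          (subst₂ (λ u v → u ! ℕ.* n ! ℕ.≤ (n ℕ.+ n ∸ k) ! ℕ.* v !) e₁ (ℕP.m∸n+n≡m n≤k)
            (!-log-convex {n ℕ.+ n ∸ k} {n} (k ∸ n) le))
    where
    le : n ℕ.+ n ∸ k ℕ.≤ n
    le = ℕP.≤-trans (ℕP.∸-monoʳ-≤ (n ℕ.+ n) n≤k) (ℕP.≤-reflexive (ℕP.m+n∸n≡m n n))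
    e₁ : (k ∸ n) ℕ.+ (n ℕ.+ n ∸ k) ≡ n
    e₁ = ℕP.+-cancelʳ-≡ n _ _ (trans (lem (k ∸ n) (n ℕ.+ n ∸ k) n)
           (trans (cong (n ℕ.+ n ∸ k ℕ.+_) (ℕP.m∸n+n≡m n≤k)) (ℕP.m∸n+n≡m k≤2n)))
      where
      lem : ∀ a b c → a ℕ.+ b ℕ.+ c ≡ b ℕ.+ (a ℕ.+ c)
      lem a b c = trans (cong (ℕ._+ c) (ℕP.+-comm a b)) (ℕP.+-assoc b a c)

  -- C(2n, k) k! (2n - k)! is the same for all k, so the coefficient is largest where the product of
  -- factorials is smallest.
  C-central : ∀ n k → k ℕ.≤ n ℕ.+ n → (n ℕ.+ n) C k ℕ.≤ (n ℕ.+ n) C n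
  C-central n k k≤2n = ℕP.*-cancelʳ-≤ _ _ (n ! ℕ.* n !) {{ℕP.m*n≢0 (n !) (n !) {{n ℕP.!≢0}} {{n ℕP.!≢0}}}} (begin
    ((n ℕ.+ n) C k) ℕ.* (n ! ℕ.* n !)                     ≤⟨ ℕP.*-monoʳ-≤ ((n ℕ.+ n) C k) (!-central n k k≤2n) ⟩
    ((n ℕ.+ n) C k) ℕ.* (k ! ℕ.* (n ℕ.+ n ∸ k) !)         ≡⟨ nCk*k![n-k]! k≤2n ⟩
    (n ℕ.+ n) !                                         ≡⟨ sym (nCk*k![n-k]! (ℕP.m≤m+n n n)) ⟩
    ((n ℕ.+ n) C n) ℕ.* (n ! ℕ.* (n ℕ.+ n ∸ n) !)         ≡⟨ cong (λ m → ((n ℕ.+ n) C n) ℕ.* (n ! ℕ.* m !)) (ℕP.m+n∸n≡m n n) ⟩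
    ((n ℕ.+ n) C n) ℕ.* (n ! ℕ.* n !) ∎)
    where open ℕP.≤-Reasoning

  C-central>0 : ∀ n → 0 ℕ.< (n ℕ.+ n) C n
  C-central>0 n = ℕP.≤-trans (ℕP.≤-reflexive (sym (nCn≡1 (n ℕ.+ n)))) (C-central n (n ℕ.+ n) ℕP.≤-refl)

  -- Two-sided bounds and the slope at 0 of a bounded polynomial.

  sign-±1 : ∀ i → sign i ≡ 1ℚ ⊎ sign i ≡ - 1ℚ
  sign-±1 zero = inj₁ refl
  sign-±1 (suc i) with sign-±1 i
  ... | inj₁ e = inj₂ (cong -_ e)
  ... | inj₂ e = inj₁ (cong -_ e)

  ∣_∣≤_ : ℚ → ℚ → Set
  ∣ x ∣≤ b = - b ≤ x × x ≤ b

  neg-swap : ∀ {b x} → - b ≤ x → - x ≤ b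
  neg-swap {b} h = subst (_ ≤_) (neg-involutive b) (neg-antimono-≤ h)
    where
    neg-involutive : ∀ b → - - b ≡ b
    neg-involutive = solve-∀ ℚ-ring

  abs-neg : ∀ {b x} → ∣ x ∣≤ b → ∣ - x ∣≤ b
  abs-neg (l , u) = neg-antimono-≤ u , neg-swap l

  abs-+ : ∀ {b c x y} → ∣ x ∣≤ b → ∣ y ∣≤ c → ∣ x + y ∣≤ (b + c)
  abs-+ {b} {c} (l , u) (l′ , u′) =
    subst (_≤ _) (sym (neg-distrib-+ b c)) (+-mono-≤ l l′) , +-mono-≤ u u′

  abs-nonNeg : ∀ {b x} → 0ℚ ≤ x → x ≤ b → ∣ x ∣≤ b
  abs-nonNeg p u = ≤-trans (neg-antimono-≤ (≤-trans p u)) p , u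

  abs-sign : ∀ i {b x} → ∣ x ∣≤ b → ∣ sign i * x ∣≤ b
  abs-sign i {b} {x} h with sign i | sign-±1 i
  ... | _ | inj₁ refl = subst (∣_∣≤ b) (sym (*-identityˡ x)) h
  ... | _ | inj₂ refl = subst (∣_∣≤ b) (lem x) (abs-neg h)
    where
    lem : ∀ x → - x ≡ - 1ℚ * x
    lem = solve-∀ ℚ-ring

  sign*sign : ∀ i → sign i * sign i ≡ 1ℚ
  sign*sign i with sign i | sign-±1 i
  ... | _ | inj₁ refl = refl
  ... | _ | inj₂ refl = refl

  abs-∑ : ∀ n {f g} → (∀ i → i ℕ.< n → ∣ f i ∣≤ g i) → ∣ ∑ n f ∣≤ ∑ n g
  abs-∑ zero h = ≤-refl , ≤-refl
  abs-∑ (suc n) h = abs-+ (h 0 (ℕ.s≤s ℕ.z≤n)) (abs-∑ n (λ i lt → h (suc i) (ℕ.s≤s lt)))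

  *-mono-≤ : ∀ {a b c d} → 0ℚ ≤ a → 0ℚ ≤ d → a ≤ b → c ≤ d → a * c ≤ b * d
  *-mono-≤ {a} {b} {c} {d} a≥0 d≥0 a≤b c≤d = ≤-trans (*-monoˡ-≤ a≥0 c≤d)
    (subst₂ _≤_ (*-comm d a) (*-comm d b) (*-monoˡ-≤ d≥0 a≤b))

  UnitBounded : (ℚ → ℚ) → Set
  UnitBounded q = ∀ x → 0ℚ ≤ x → x ≤ 1ℚ → 0ℚ ≤ q x × q x ≤ 1ℚ

  -- 2 gap k is a telescoping majorant of 1 / (k + 1)².
  gap : ℕ → ℚ
  gap k = inv k - inv (suc k)

  gap-* : ∀ k → gap k ≡ inv k * inv (suc k)
  gap-* k = begin
    inv k - inv (suc k)
      ≡⟨ cong₂ _-_ (sym (*-identityˡ (inv k))) (sym (*-identityˡ (inv (suc k)))) ⟩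
    1ℚ * inv k - 1ℚ * inv (suc k)
      ≡⟨ cong₂ (λ u v → u * inv k - v * inv (suc k)) (sym (inv-inverse (suc k))) (sym (inv-inverse k)) ⟩
    (1ℚ + ι (suc k)) * inv (suc k) * inv k - ι (suc k) * inv k * inv (suc k)
      ≡⟨ lem (ι (suc k)) (inv k) (inv (suc k)) ⟩
    inv k * inv (suc k) ∎
    where
    open ≡-Reasoning
    lem : ∀ a u v → (1ℚ + a) * v * u - a * u * v ≡ u * v
    lem = solve-∀ ℚ-ring

  2ℚ : ℚ
  2ℚ = 1ℚ + 1ℚ

  -- By `gap-*` the right-hand side is 2 (k + 1) / (k + 2), which exceeds 1 by k / (k + 2).
  1≤sq*2gap : ∀ k → 1ℚ ≤ ι (suc k) * ι (suc k) * (2ℚ * gap k)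
  1≤sq*2gap k = 0≤-⇒≤ (subst (0ℚ ≤_) (sym eq) (0≤* (0≤ι k) (<⇒≤ (0<inv (suc k)))))
    where
    open ≡-Reasoning
    lem₁ : ∀ a u v → a * a * (2ℚ * (u * v)) ≡ 2ℚ * a * (a * u) * v
    lem₁ = solve-∀ ℚ-ring
    lem₂ : ∀ k v → 2ℚ * (1ℚ + k) * 1ℚ * v - (1ℚ + (1ℚ + k)) * v ≡ k * v
    lem₂ = solve-∀ ℚ-ring
    eq : ι (suc k) * ι (suc k) * (2ℚ * gap k) - 1ℚ ≡ ι k * inv (suc k)
    eq = begin
      ι (suc k) * ι (suc k) * (2ℚ * gap k) - 1ℚ
        ≡⟨ cong (λ g → ι (suc k) * ι (suc k) * (2ℚ * g) - 1ℚ) (gap-* k) ⟩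
      ι (suc k) * ι (suc k) * (2ℚ * (inv k * inv (suc k))) - 1ℚ
        ≡⟨ cong (_- 1ℚ) (lem₁ (ι (suc k)) (inv k) (inv (suc k))) ⟩
      2ℚ * ι (suc k) * (ι (suc k) * inv k) * inv (suc k) - 1ℚ
        ≡⟨ cong₂ (λ u v → 2ℚ * ι (suc k) * u * inv (suc k) - v) (inv-inverse k) (sym (inv-inverse (suc k))) ⟩
      2ℚ * ι (suc k) * 1ℚ * inv (suc k) - ι (suc (suc k)) * inv (suc k)
        ≡⟨ lem₂ (ι k) (inv (suc k)) ⟩
      ι k * inv (suc k) ∎

  -- The 2D-th difference of y ↦ r((y − D)² / D²), a polynomial of degree less than 2D, vanishes. Its central term
  -- is r(0) times the largest binomial coefficient; the others are bounded by r(x) ≤ 1 / x at x = j² / D².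
  module Markov {e : ℕ} {r : ℚ → ℚ} (P : Poly e r) (bounded : UnitBounded (λ x → x * r x)) where

    D N M : ℕ
    D = suc e
    -- Chosen so that `suc M` reduces to `N`; thus `ν` is 1 / N.
    M = e ℕ.+ e ℕ.* D
    N = D ℕ.* D

    ν : ℚ
    ν = inv M

    N*ν : ι N * ν ≡ 1ℚ
    N*ν = inv-inverse M

    node : ℕ → ℚ
    node k = ι k * ι k * ν

    0<node : ∀ k → 0ℚ < node (suc k)
    0<node k = positive⁻¹ _ {{pos*pos⇒pos (ι (suc k) * ι (suc k)) {{pos*pos⇒pos a {{p}} a {{p}}}} ν {{positive (0<inv M)}}}}
      where
      a = ι (suc k)
      p = positive (ι-suc>0 k)

    node≤1 : ∀ k → k ℕ.≤ D → node k ≤ 1ℚ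
    node≤1 k k≤D = subst₂ _≤_ refl N*ν
      (subst (λ s → s * ν ≤ ι N * ν) (ι-* k k)
        (*-monoʳ-≤-nonNeg ν {{nonNegative (<⇒≤ (0<inv M))}} (ι-mono (ℕP.*-mono-≤ k≤D k≤D))))

    -- Cancel x > 0 in 0 ≤ x r(x) and in x r(x) ≤ 1 ≤ x B. Since x = (k + 1)² / N, the inequality 1
    -- ≤ x B is `1≤sq*2gap`.
    r-node : ∀ k → suc k ℕ.≤ D → 0ℚ ≤ r (node (suc k)) × r (node (suc k)) ≤ ι N * (2ℚ * gap k)
    r-node k k<D = lower , upper
      where
      x = node (suc k)
      B = ι N * (2ℚ * gap k)
      instance
        x-pos : Positive x
        x-pos = positive (0<node k)
      bx = bounded x (<⇒≤ (0<node k)) (node≤1 (suc k) k<D)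
      lower : 0ℚ ≤ r x
      lower = *-cancelˡ-≤-pos x (subst (_≤ x * r x) (sym (*-zeroʳ x)) (proj₁ bx))
      lem : ∀ a v n g → a * v * (n * g) ≡ a * g * (n * v)
      lem = solve-∀ ℚ-ring
      xB : x * B ≡ ι (suc k) * ι (suc k) * (2ℚ * gap k)
      xB = trans (lem (ι (suc k) * ι (suc k)) ν (ι N) (2ℚ * gap k)) (trans (cong (ι (suc k) * ι (suc k) * (2ℚ * gap k) *_) N*ν) (*-identityʳ _))
      upper : r x ≤ B
      upper = *-cancelˡ-≤-pos x (≤-trans (proj₂ bx) (subst (1ℚ ≤_) (sym xB) (1≤sq*2gap k)))

    shifted : ℚ → ℚ
    shifted y = (y - ι D) * (y - ι D) * ν

    shifted-poly : Poly (e ℕ.* 2) (λ y → r (shifted y))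
    shifted-poly = poly-∘ P (poly-≗ (λ y → *-comm _ ν) (poly-scale ν (poly-* lin lin)))
      where
      lin : Poly 1 (λ y → y - ι D)
      lin = poly-+ poly-id (const (- ι D) (λ _ → refl))

    Cc : ℕ
    Cc = (D ℕ.+ D) C D

    f : ℕ → ℚ
    f i = sign i * ι ((D ℕ.+ D) C i) * r (shifted (ι i))

    -- The 2D + 1 terms are grouped as left side, centre and right side. The polynomial has degree
    -- at most 2e = 2D - 2, below the order 2D of the difference.
    ∑f≡0 : ∑ D f + (f (D ℕ.+ 0) + ∑ D (λ i → f (D ℕ.+ suc i))) ≡ 0ℚ
    ∑f≡0 = trans (sym (∑-split D (suc D) f)) (trans (cong (λ m → ∑ m f) (ℕP.+-suc D D))
      (trans (sym (alt-binomial (D ℕ.+ D) (λ i → r (shifted (ι i))))) (alt-vanish lt shifted-poly)))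
      where
      lt : e ℕ.* 2 ℕ.< D ℕ.+ D
      lt = subst (ℕ._< D ℕ.+ D) (trans (cong (e ℕ.+_) (sym (ℕP.+-identityʳ e))) (ℕP.*-comm 2 e))
             (ℕP.+-mono-< (ℕP.n<1+n e) (ℕP.n<1+n e))

    K : ℚ
    K = ι Cc * (ι N * 2ℚ)

    term-bound : ∀ i k → suc k ℕ.≤ D → i ℕ.≤ D ℕ.+ D → shifted (ι i) ≡ node (suc k) → ∣ f i ∣≤ (K * gap k)
    term-bound i k k<D i≤2D eq = subst (∣_∣≤ (K * gap k))
      (trans (cong (λ y → sign i * (ι ((D ℕ.+ D) C i) * r y)) (sym eq)) (sym (*-assoc (sign i) _ _)))
      (abs-sign i (abs-nonNeg (0≤* (0≤ι c) lo)
        (subst (ι c * r (node (suc k)) ≤_) (lem (ι Cc) (ι N) (gap k)) (*-mono-≤ (0≤ι c) (≤-trans lo hi) (ι-mono (C-central D i i≤2D)) hi))))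
      where
      lo = proj₁ (r-node k k<D)
      hi = proj₂ (r-node k k<D)
      c = (D ℕ.+ D) C i
      lem : ∀ c n g → c * (n * (2ℚ * g)) ≡ c * (n * 2ℚ) * g
      lem = solve-∀ ℚ-ring

    left-bound : ∀ i → i ℕ.< D → ∣ f i ∣≤ (K * gap (D ∸ suc i))
    left-bound i i<D = term-bound i k (ℕP.≤-trans (ℕP.≤-reflexive 1+k) (ℕP.m∸n≤m D i))
      (ℕP.≤-trans (ℕP.<⇒≤ i<D) (ℕP.m≤m+n D D)) eq
      where
      k = D ∸ suc i
      1+k : suc k ≡ D ∸ i
      1+k = sym (ℕP.+-∸-assoc 1 i<D)
      ιD : ι D ≡ ι i + ι (suc k)
      ιD = trans (cong ι (sym (trans (cong (i ℕ.+_) 1+k) (ℕP.m+[n∸m]≡n (ℕP.<⇒≤ i<D))))) (ι-+ i (suc k))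
      lem : ∀ i k v → (i - (i + k)) * (i - (i + k)) * v ≡ k * k * v
      lem = solve-∀ ℚ-ring
      eq : shifted (ι i) ≡ node (suc k)
      eq = trans (cong (λ d → (ι i - d) * (ι i - d) * ν) ιD) (lem (ι i) (ι (suc k)) ν)

    right-bound : ∀ k → k ℕ.< D → ∣ f (D ℕ.+ suc k) ∣≤ (K * gap k)
    right-bound k k<D = term-bound (D ℕ.+ suc k) k k<D (ℕP.+-monoʳ-≤ D k<D)
      (trans (cong (λ y → (y - ι D) * (y - ι D) * ν) (ι-+ D (suc k))) (lem (ι D) (ι (suc k)) ν))
      where
      lem : ∀ i k v → (i + k - i) * (i + k - i) * v ≡ k * k * v
      lem = solve-∀ ℚ-ring

    -- The gaps telescope to 1 - 1 / (D + 1).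
    ∑gap : ∑ D (λ k → K * gap k) ≤ K
    ∑gap = subst₂ _≤_ (sym (trans (∑-scale D K gap) (cong (K *_) (∑-telescope D inv)))) (*-identityʳ K)
      (*-monoˡ-≤ (0≤* (0≤ι Cc) (0≤* (0≤ι N) (0≤+ 0≤1 0≤1)))
        (subst (1ℚ - inv D ≤_) (+-identityʳ 1ℚ) (+-monoʳ-≤ 1ℚ (neg-antimono-≤ (<⇒≤ (0<inv D))))))

    widen : ∀ {x b c} → b ≤ c → ∣ x ∣≤ b → ∣ x ∣≤ c
    widen h (l , u) = ≤-trans (neg-antimono-≤ h) l , ≤-trans u h

    left : ∣ ∑ D f ∣≤ K
    left = widen (subst (_≤ K) (sym (∑-reverse D (λ k → K * gap k))) ∑gap) (abs-∑ D left-bound)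

    right : ∣ ∑ D (λ i → f (D ℕ.+ suc i)) ∣≤ K
    right = widen ∑gap (abs-∑ D right-bound)

    -- By `∑f≡0` the central term is minus the sum of the two sides, each of absolute value at most
    -- K. A second factor `sign D` cancels the sign of the term.
    center : ∣ ι Cc * r 0ℚ ∣≤ (K + K)
    center = subst (∣_∣≤ (K + K)) eq (abs-sign D (abs-neg (abs-+ left right)))
      where
      lem₁ : ∀ l c r → l + (c + r) ≡ 0ℚ → - (l + r) ≡ c
      lem₁ l c r h = trans (lem l c r) (trans (cong (_+_ c) (cong -_ h)) (+-identityʳ c))
        where
        lem : ∀ l c r → - (l + r) ≡ c - (l + (c + r))
        lem = solve-∀ ℚ-ring
      lem₂ : ∀ d v → (d - d) * (d - d) * v ≡ 0ℚ
      lem₂ = solve-∀ ℚ-ring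
      lem₃ : ∀ s c r → s * (s * c * r) ≡ s * s * (c * r)
      lem₃ = solve-∀ ℚ-ring
      eq : sign D * - (∑ D f + ∑ D (λ i → f (D ℕ.+ suc i))) ≡ ι Cc * r 0ℚ
      eq = trans (cong (sign D *_) (trans (lem₁ (∑ D f) _ _ ∑f≡0)
             (trans (cong f (ℕP.+-identityʳ D)) (cong (λ y → sign D * ι Cc * r y) (lem₂ (ι D) ν)))))
           (trans (lem₃ (sign D) (ι Cc) (r 0ℚ)) (trans (cong (_* (ι Cc * r 0ℚ)) (sign*sign D)) (*-identityˡ _)))

    -- K is 2 N times the central coefficient, so cancelling that coefficient in `center` leaves 2 ·
    -- 2 N.
    markov : r 0ℚ ≤ ι (4 ℕ.* N)
    markov = *-cancelˡ-≤-pos (ι Cc) {{positive (<-≤-trans (ι-suc>0 0) (ι-mono (C-central>0 D)))}}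
      (subst (ι Cc * r 0ℚ ≤_) (trans (lem (ι Cc) (ι N)) (cong (ι Cc *_) (sym (ι-* 4 N)))) (proj₂ center))
      where
      lem : ∀ c n → c * (n * 2ℚ) + c * (n * 2ℚ) ≡ c * ((1ℚ + (1ℚ + (1ℚ + (1ℚ + 0ℚ)))) * n)
      lem = solve-∀ ℚ-ring

-- Multilinear polynomials on the cube with integer coefficients.

module IntegerPolynomials where

  open import Data.Bool using (Bool; true; false; if_then_else_)
  open import Data.Fin using (Fin; zero; suc)
  open import Data.Integer hiding (suc; pred; _^_) renaming (+_ to int)
  open import Data.Integer.Properties
  open import Data.Integer.Tactic.RingSolver using (solve-∀)
  open import Data.List as L using (List; []; _∷_)
  import Data.List.Properties as LP
  open import Data.Nat as ℕ using (ℕ; zero; suc; _^_; _∸_)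
  import Data.Nat.Properties as ℕP
  open import Data.Product using (Σ; _,_; _×_; proj₁)
  open import Data.Sum using (_⊎_; inj₁; inj₂; [_,_]′)
  open import Data.Vec using (Vec; []; _∷_; lookup; _[_]≔_; replicate)
  import Data.Vec.Properties as VP
  open import Relation.Binary.PropositionalEquality
  open import Relation.Nullary using (yes; no; contradiction)

  lo hi : ∀ {n} → Coeffs (suc n) → Coeffs n
  lo a S = a (false ∷ S)
  hi a S = a (true ∷ S)

  -- Evaluation along the splitting into `lo` and `hi` replaces the sum over all subsets, so that
  -- inductions can remove the first variable.
  ev : ∀ {n} → Coeffs n → Vec Bool n → ℤ
  ev a [] = a []
  ev a (b ∷ x) = ev (lo a) x + toℤ b * ev (hi a) x

  sumℤ-++ : ∀ xs ys → sumℤ (xs L.++ ys) ≡ sumℤ xs + sumℤ ys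
  sumℤ-++ [] ys = sym (+-identityˡ (sumℤ ys))
  sumℤ-++ (x ∷ xs) ys = trans (cong (x +_) (sumℤ-++ xs ys)) (sym (+-assoc x (sumℤ xs) (sumℤ ys)))

  sumℤ-scale : ∀ {A : Set} c (g : A → ℤ) xs → sumℤ (L.map (λ x → c * g x) xs) ≡ c * sumℤ (L.map g xs)
  sumℤ-scale c g [] = sym (*-zeroʳ c)
  sumℤ-scale c g (x ∷ xs) = trans (cong (c * g x +_) (sumℤ-scale c g xs)) (sym (*-distribˡ-+ c (g x) _))

  evalPoly≡ev : ∀ {n} (a : Coeffs n) x → evalPoly a x ≡ ev a x
  evalPoly≡ev a [] = trans (+-identityʳ (a [] * 1ℤ)) (*-identityʳ (a []))
  evalPoly≡ev {suc n} a (b ∷ x) = begin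
    sumℤ (L.map g (L.map (false ∷_) V L.++ L.map (true ∷_) V))
      ≡⟨ cong sumℤ (LP.map-++ g (L.map (false ∷_) V) (L.map (true ∷_) V)) ⟩
    sumℤ (L.map g (L.map (false ∷_) V) L.++ L.map g (L.map (true ∷_) V))
      ≡⟨ sumℤ-++ (L.map g (L.map (false ∷_) V)) _ ⟩
    sumℤ (L.map g (L.map (false ∷_) V)) + sumℤ (L.map g (L.map (true ∷_) V))
      ≡⟨ cong₂ _+_ (cong sumℤ (sym (LP.map-∘ V))) (cong sumℤ (sym (LP.map-∘ V))) ⟩
    evalPoly (lo a) x + sumℤ (L.map (λ S → a (true ∷ S) * (toℤ b * monomial S x)) V)
      ≡⟨ cong (λ l → evalPoly (lo a) x + sumℤ l) (LP.map-cong (λ S → lem (hi a S) (toℤ b) (monomial S x)) V) ⟩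
    evalPoly (lo a) x + sumℤ (L.map (λ S → toℤ b * (hi a S * monomial S x)) V)
      ≡⟨ cong (evalPoly (lo a) x +_) (sumℤ-scale (toℤ b) (λ S → hi a S * monomial S x) V) ⟩
    evalPoly (lo a) x + toℤ b * evalPoly (hi a) x
      ≡⟨ cong₂ (λ u v → u + toℤ b * v) (evalPoly≡ev (lo a) x) (evalPoly≡ev (hi a) x) ⟩
    ev (lo a) x + toℤ b * ev (hi a) x ∎
    where
    open ≡-Reasoning
    V = allVecs n
    g : Vec Bool (suc n) → ℤ
    g S = a S * monomial S (b ∷ x)
    lem : ∀ a b m → a * (b * m) ≡ b * (a * m)
    lem = solve-∀

  ev-cong : ∀ {n} {a b : Coeffs n} → a ≗ b → ev a ≗ ev b
  ev-cong e [] = e []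
  ev-cong e (c ∷ x) = cong₂ (λ u v → u + toℤ c * v) (ev-cong (λ S → e (false ∷ S)) x) (ev-cong (λ S → e (true ∷ S)) x)

  ev-linear : ∀ {n} c d (a b : Coeffs n) x → ev (λ S → c * a S + d * b S) x ≡ c * ev a x + d * ev b x
  ev-linear c d a b [] = refl
  ev-linear c d a b (t ∷ x) =
    trans (cong₂ (λ u v → u + toℤ t * v) (ev-linear c d (lo a) (lo b) x) (ev-linear c d (hi a) (hi b) x))
          (lem c d (ev (lo a) x) (ev (lo b) x) (ev (hi a) x) (ev (hi b) x) (toℤ t))
    where
    lem : ∀ c d u v w z t → c * u + d * v + t * (c * w + d * z) ≡ c * (u + t * w) + d * (v + t * z)
    lem = solve-∀

  ev-0 : ∀ {n} {a : Coeffs n} → (∀ S → a S ≡ 0ℤ) → ∀ x → ev a x ≡ 0ℤ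
  ev-0 e [] = e []
  ev-0 e (b ∷ x) = cong₂ (λ u v → u + v) (ev-0 (λ S → e (false ∷ S)) x)
    (trans (cong (toℤ b *_) (ev-0 (λ S → e (true ∷ S)) x)) (*-zeroʳ (toℤ b)))

  ∅ : ∀ {n} → Vec Bool n
  ∅ = replicate _ false

  size-∅ : ∀ n → size (∅ {n}) ≡ 0
  size-∅ zero = refl
  size-∅ (suc n) = size-∅ n

  ZeroOne : ∀ {n} → Coeffs n → Set
  ZeroOne a = ∀ x → ev a x ≡ 0ℤ ⊎ ev a x ≡ 1ℤ

  deg-lo : ∀ {n d} {a : Coeffs (suc n)} → DegreeAtMost a d → DegreeAtMost (lo a) d
  deg-lo deg S = deg (false ∷ S)

  deg-hi : ∀ {n d} {a : Coeffs (suc n)} → DegreeAtMost a (suc d) → DegreeAtMost (hi a) d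
  deg-hi deg S h = deg (true ∷ S) (ℕ.s≤s h)

  deg-hi-0 : ∀ {n} {a : Coeffs (suc n)} → DegreeAtMost a 0 → ∀ S → hi a S ≡ 0ℤ
  deg-hi-0 deg S = deg (true ∷ S) (ℕ.s≤s ℕ.z≤n)

  -- Exact degree and the weight of a polynomial.

  Top : ∀ {n} → Coeffs n → Set
  Top {n} b = Σ (Vec Bool n) λ S → b S ≢ 0ℤ × DegreeAtMost b (size S)

  top? : ∀ {n} (b : Coeffs n) → (∀ S → b S ≡ 0ℤ) ⊎ Top b
  top? {zero} b with b [] ≟ 0ℤ
  ... | yes e = inj₁ λ { [] → e }
  ... | no ne = inj₂ ([] , ne , λ { [] () })
  top? {suc n} b with top? (lo b) | top? (hi b)
  ... | inj₁ z₀ | inj₁ z₁ = inj₁ λ { (false ∷ S) → z₀ S ; (true ∷ S) → z₁ S }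
  ... | inj₁ z₀ | inj₂ (S , ne , deg) = inj₂ (true ∷ S , ne , λ { (false ∷ S′) _ → z₀ S′ ; (true ∷ S′) h → deg S′ (ℕP.≤-pred h) })
  ... | inj₂ (S , ne , deg) | inj₁ z₁ = inj₂ (false ∷ S , ne , λ { (false ∷ S′) h → deg S′ h ; (true ∷ S′) _ → z₁ S′ })
  ... | inj₂ (S₀ , ne₀ , deg₀) | inj₂ (S₁ , ne₁ , deg₁) with size S₀ ℕP.≤? suc (size S₁)
  ...   | yes le = inj₂ (true ∷ S₁ , ne₁ , λ { (false ∷ S′) h → deg₀ S′ (ℕP.≤-<-trans le h) ; (true ∷ S′) h → deg₁ S′ (ℕP.≤-pred h) })
  ...   | no gt = inj₂ (false ∷ S₀ , ne₀ , λ { (false ∷ S′) h → deg₀ S′ h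
                      ; (true ∷ S′) h → deg₁ S′ (ℕP.≤-pred (ℕP.<-trans (ℕP.≰⇒> gt) h)) })

  size≤n : ∀ {n} (S : Vec Bool n) → size S ℕ.≤ n
  size≤n [] = ℕ.z≤n
  size≤n (true ∷ S) = ℕ.s≤s (size≤n S)
  size≤n (false ∷ S) = ℕP.m≤n⇒m≤1+n (size≤n S)

  -- 2ⁿ⁻ᵉ for a nonzero polynomial of degree e, and 0 for the zero polynomial, so that Φ (∂ i a) is
  -- 2ⁿ⁺¹ times the weight of xᵢ.
  Φ : ∀ {n} → Coeffs n → ℕ
  Φ {n} b = [ (λ _ → 0) , (λ t → 2 ^ (n ∸ size (proj₁ t))) ]′ (top? b)

  degree-≥ : ∀ {n e} {b : Coeffs n} {S} → b S ≢ 0ℤ → DegreeAtMost b e → size S ℕ.≤ e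
  degree-≥ {e = e} {S = S} ne deg with size S ℕP.≤? e
  ... | yes le = le
  ... | no gt = contradiction (deg S (ℕP.≰⇒> gt)) ne

  2^-split : ∀ {m n} → m ℕ.≤ n → 2 ^ m ℕ.* 2 ^ (n ∸ m) ≡ 2 ^ n
  2^-split {m} {n} le = trans (sym (ℕP.^-distribˡ-+-* 2 m (n ∸ m))) (cong (2 ^_) (ℕP.m+[n∸m]≡n le))

  2^-mono : ∀ {m n} → m ℕ.≤ n → 2 ^ m ℕ.≤ 2 ^ n
  2^-mono = ℕP.^-monoʳ-≤ 2

  Φ-lower : ∀ {n e} {b : Coeffs n} {S} → b S ≢ 0ℤ → DegreeAtMost b e → 2 ^ n ℕ.≤ 2 ^ e ℕ.* Φ b
  Φ-lower {b = b} {S} ne deg with top? b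
  ... | inj₁ z = contradiction (z S) ne
  ... | inj₂ (S′ , ne′ , deg′) = ℕP.≤-trans (ℕP.≤-reflexive (sym (2^-split (size≤n S′))))
          (ℕP.*-monoˡ-≤ _ (2^-mono (degree-≥ {b = b} ne′ deg)))

  Φ-upper : ∀ {n} {b : Coeffs n} {S} → b S ≢ 0ℤ → 2 ^ size S ℕ.* Φ b ℕ.≤ 2 ^ n
  Φ-upper {b = b} {S} ne with top? b
  ... | inj₁ z = contradiction (z S) ne
  ... | inj₂ (S′ , ne′ , deg′) = ℕP.≤-trans (ℕP.*-monoˡ-≤ _ (2^-mono (degree-≥ {b = b} ne deg′)))
          (ℕP.≤-reflexive (2^-split (size≤n S′)))

  Φ-zero : ∀ {n} {b : Coeffs n} → (∀ S → b S ≡ 0ℤ) → Φ b ≡ 0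
  Φ-zero {b = b} z with top? b
  ... | inj₁ _ = refl
  ... | inj₂ (S , ne , _) = contradiction (z S) ne

  -- Pointwise equality does not identify `top? a` with `top? b`. The top monomial of a is still
  -- nonzero in b and its size bounds the degree of b, so `Φ-lower` applies.
  Φ-≗ : ∀ {n} {a b : Coeffs n} → a ≗ b → Φ a ℕ.≤ Φ b
  Φ-≗ {a = a} {b} eq with top? a in eq′
  ... | inj₁ _ = ℕ.z≤n
  ... | inj₂ (S , ne , deg) = ℕP.*-cancelˡ-≤ (2 ^ size S) {{ℕP.m^n≢0 2 (size S)}}
    (ℕP.≤-trans (ℕP.≤-reflexive (2^-split (size≤n S)))
      (Φ-lower {b = b} {S} (λ e → ne (trans (eq S) e)) (λ S′ h → trans (sym (eq S′)) (deg S′ h))))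

  -- Fixing a variable and taking the coefficient of a variable, with n kept unchanged.

  restrict : ∀ {n} → Fin n → Bool → Coeffs n → Coeffs n
  restrict j c b S = if lookup S j then 0ℤ else b S + toℤ c * b (S [ j ]≔ true)

  ∂ : ∀ {n} → Fin n → Coeffs n → Coeffs n
  ∂ i a S = if lookup S i then 0ℤ else a (S [ i ]≔ true)

  restrict-∈ : ∀ {n} {j : Fin n} {c b S} → lookup S j ≡ true → restrict j c b S ≡ 0ℤ
  restrict-∈ e rewrite e = refl

  restrict-∉ : ∀ {n} {j : Fin n} {c b S} → lookup S j ≡ false → restrict j c b S ≡ b S + toℤ c * b (S [ j ]≔ true)
  restrict-∉ e rewrite e = refl

  ∂-∈ : ∀ {n} {i : Fin n} {a S} → lookup S i ≡ true → ∂ i a S ≡ 0ℤ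
  ∂-∈ e rewrite e = refl

  ∂-∉ : ∀ {n} {i : Fin n} {a S} → lookup S i ≡ false → ∂ i a S ≡ a (S [ i ]≔ true)
  ∂-∉ e rewrite e = refl

  size-insert-∉ : ∀ {n} (S : Vec Bool n) j → lookup S j ≡ false → size (S [ j ]≔ true) ≡ suc (size S)
  size-insert-∉ (false ∷ S) zero e = refl
  size-insert-∉ (true ∷ S) (suc j) e = cong suc (size-insert-∉ S j e)
  size-insert-∉ (false ∷ S) (suc j) e = size-insert-∉ S j e

  c*0 : ∀ c {i j} → i ≡ 0ℤ → j ≡ 0ℤ → i + toℤ c * j ≡ 0ℤ
  c*0 c refl refl = trans (+-identityˡ _) (*-zeroʳ (toℤ c))

  deg-restrict : ∀ {n e} j c {b : Coeffs n} → DegreeAtMost b e → DegreeAtMost (restrict j c b) e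
  deg-restrict j c {b} deg S h with lookup S j in eq
  ... | true = refl
  ... | false = c*0 c (deg S h) (deg _ (ℕP.<-trans h (ℕP.≤-reflexive (sym (size-insert-∉ S j eq)))))

  restrict-false-∉ : ∀ {n} {j : Fin n} {b S} → lookup S j ≡ false → restrict j false b S ≡ b S
  restrict-false-∉ {j = j} {b} {S} e = trans (restrict-∉ {c = false} {b = b} e)
    (trans (cong (λ z → b S + z) (*-zeroˡ (b (S [ j ]≔ true)))) (+-identityʳ (b S)))

  restrict-true-∉ : ∀ {n} {j : Fin n} {b S} → lookup S j ≡ false → restrict j true b S ≡ b S + b (S [ j ]≔ true)
  restrict-true-∉ {j = j} {b} {S} e = trans (restrict-∉ {c = true} {b = b} e) (cong (λ z → b S + z) (*-identityˡ (b (S [ j ]≔ true))))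

  -- b = (1 - xⱼ) b₀ + xⱼ b₁ for the two restrictions. If j lies in S, the coefficient at S is the
  -- difference of those of b₁ and b₀ at S without j.
  restrict-both-0 : ∀ {n} j {b : Coeffs n} → (∀ S → restrict j false b S ≡ 0ℤ) → (∀ S → restrict j true b S ≡ 0ℤ) →
                    ∀ S → b S ≡ 0ℤ
  restrict-both-0 j {b} z₀ z₁ S with lookup S j in eq
  ... | false = trans (sym (restrict-false-∉ {b = b} eq)) (z₀ S)
  ... | true = begin
      b S                            ≡⟨ cong b (sym S″) ⟩
      b (S′ [ j ]≔ true)             ≡⟨ sym (+-identityˡ _) ⟩
      0ℤ + b (S′ [ j ]≔ true)        ≡⟨ cong (λ z → z + b (S′ [ j ]≔ true)) (trans (sym (z₀ S′)) (restrict-false-∉ {b = b} out)) ⟩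
      b S′ + b (S′ [ j ]≔ true)      ≡⟨ sym (restrict-true-∉ {b = b} out) ⟩
      restrict j true b S′           ≡⟨ z₁ S′ ⟩
      0ℤ ∎
    where
    open ≡-Reasoning
    S′ = S [ j ]≔ false
    out : lookup S′ j ≡ false
    out = VP.lookup∘update j S false
    S″ : S′ [ j ]≔ true ≡ S
    S″ = trans (VP.[]≔-idempotent S j) (trans (cong (S [ j ]≔_) (sym eq)) (VP.[]≔-lookup S j))

  -- If one restriction of a nonzero polynomial vanishes, then xⱼ or 1 − xⱼ divides it,
  -- and the degree of the other restriction is smaller.
  deg-drop : ∀ {n e} j {b : Coeffs n} c c′ → c ≢ c′ → (∀ S → restrict j c b S ≡ 0ℤ) → DegreeAtMost b (suc e) →
             DegreeAtMost (restrict j c′ b) e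
  deg-drop j false false ne z deg = contradiction refl ne
  deg-drop j true true ne z deg = contradiction refl ne
  deg-drop j {b} false true _ z deg S h with lookup S j in eq
  ... | true = refl
  ... | false = c*0 true (trans (sym (restrict-false-∉ {b = b} eq)) (z S))
                  (deg _ (ℕP.≤-trans (ℕ.s≤s h) (ℕP.≤-reflexive (sym (size-insert-∉ S j eq)))))
  deg-drop j {b} true false _ z deg S h with lookup S j in eq
  ... | true = refl
  ... | false = trans (+-identityʳ (b S)) (begin
      b S                              ≡⟨ sym (+-identityʳ (b S)) ⟩
      b S + 0ℤ                         ≡⟨ cong (λ w → b S + w) (sym (deg _ (ℕP.≤-trans (ℕ.s≤s h) (ℕP.≤-reflexive (sym (size-insert-∉ S j eq)))))) ⟩
      b S + b (S [ j ]≔ true)          ≡⟨ sym (restrict-true-∉ {b = b} eq) ⟩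
      restrict j true b S              ≡⟨ z S ⟩
      0ℤ ∎)
    where open ≡-Reasoning

  deg-drop-0 : ∀ {n} j {b : Coeffs n} c c′ → c ≢ c′ → (∀ S → restrict j c b S ≡ 0ℤ) → DegreeAtMost b 0 →
               ∀ S → restrict j c′ b S ≡ 0ℤ
  deg-drop-0 j {b} c c′ ne z deg S with lookup S j in eq
  ... | true = refl
  ... | false = c*0 c′ bS≡0 bS+≡0
    where
    bS+≡0 = deg (S [ j ]≔ true) (ℕP.≤-trans (ℕ.s≤s ℕ.z≤n) (ℕP.≤-reflexive (sym (size-insert-∉ S j eq))))
    bS≡0 : b S ≡ 0ℤ
    bS≡0 = trans (sym (trans (restrict-∉ {c = c} {b = b} eq) (trans (cong (λ z → b S + toℤ c * z) bS+≡0)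
      (trans (cong (λ z → b S + z) (*-zeroʳ (toℤ c))) (+-identityʳ (b S)))))) (z S)

  -- By `deg-drop` the surviving restriction has degree at most e - 1. This doubles the bound of
  -- `Φ-lower` and makes up for the restriction that vanishes.
  Φ-drop : ∀ {n e} j {b : Coeffs n} c c′ → c ≢ c′ → (∀ S → restrict j c b S ≡ 0ℤ) → DegreeAtMost b e →
           Top (restrict j c′ b) → 2 ^ n ℕ.+ 2 ^ n ℕ.≤ 2 ^ e ℕ.* Φ (restrict j c′ b)
  Φ-drop {e = zero} j {b} c c′ ne z deg (S , nz , _) = contradiction (deg-drop-0 j {b} c c′ ne z deg S) nz
  Φ-drop {e = suc e} j {b} c c′ ne z deg (S , nz , _) =
    ℕP.≤-trans (ℕP.+-mono-≤ h h) (ℕP.≤-reflexive (trans (cong (x ℕ.+_) (sym (ℕP.+-identityʳ x))) (sym (ℕP.*-assoc 2 (2 ^ e) _))))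
    where
    x = 2 ^ e ℕ.* Φ (restrict j c′ b)
    h = Φ-lower {b = restrict j c′ b} {S} nz (deg-drop j {b} c c′ ne z deg)

  -- If both restrictions are nonzero, neither has a larger degree than b, hence neither has a
  -- smaller Φ. If one vanishes, the other pays for both by `Φ-drop`.
  Φ-restrict : ∀ {n} j (b : Coeffs n) → Φ b ℕ.+ Φ b ℕ.≤ Φ (restrict j false b) ℕ.+ Φ (restrict j true b)
  Φ-restrict {n} j b = go (top? b)
    where
    b₀ = restrict j false b
    b₁ = restrict j true b
    go : (∀ S → b S ≡ 0ℤ) ⊎ Top b → Φ b ℕ.+ Φ b ℕ.≤ Φ b₀ ℕ.+ Φ b₁
    go (inj₁ z) = ℕP.≤-trans (ℕP.≤-reflexive (cong₂ ℕ._+_ (Φ-zero {b = b} z) (Φ-zero {b = b} z))) ℕ.z≤n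
    go (inj₂ (S , nz , deg)) = ℕP.*-cancelˡ-≤ (2 ^ e) {{ℕP.m^n≢0 2 e}} (begin
      2 ^ e ℕ.* (Φ b ℕ.+ Φ b)          ≡⟨ ℕP.*-distribˡ-+ (2 ^ e) (Φ b) (Φ b) ⟩
      2 ^ e ℕ.* Φ b ℕ.+ 2 ^ e ℕ.* Φ b  ≤⟨ ℕP.+-mono-≤ (Φ-upper {b = b} nz) (Φ-upper {b = b} nz) ⟩
      2 ^ n ℕ.+ 2 ^ n                  ≤⟨ cases (top? b₀) (top? b₁) ⟩
      2 ^ e ℕ.* Φ b₀ ℕ.+ 2 ^ e ℕ.* Φ b₁ ≡⟨ sym (ℕP.*-distribˡ-+ (2 ^ e) (Φ b₀) (Φ b₁)) ⟩
      2 ^ e ℕ.* (Φ b₀ ℕ.+ Φ b₁) ∎)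
      where
      open ℕP.≤-Reasoning
      e = size S
      cases : (∀ S → b₀ S ≡ 0ℤ) ⊎ Top b₀ → (∀ S → b₁ S ≡ 0ℤ) ⊎ Top b₁ →
              2 ^ n ℕ.+ 2 ^ n ℕ.≤ 2 ^ e ℕ.* Φ b₀ ℕ.+ 2 ^ e ℕ.* Φ b₁
      cases (inj₁ z₀) (inj₁ z₁) = contradiction (restrict-both-0 j {b} z₀ z₁ S) nz
      cases (inj₁ z₀) (inj₂ t₁) = ℕP.≤-trans (Φ-drop j {b} false true (λ ()) z₀ deg t₁) (ℕP.m≤n+m _ _)
      cases (inj₂ t₀) (inj₁ z₁) = ℕP.≤-trans (Φ-drop j {b} true false (λ ()) z₁ deg t₀) (ℕP.m≤m+n _ _)
      cases (inj₂ (S₀ , nz₀ , _)) (inj₂ (S₁ , nz₁ , _)) =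
        ℕP.+-mono-≤ (Φ-lower {b = b₀} nz₀ (deg-restrict j false {b} deg)) (Φ-lower {b = b₁} nz₁ (deg-restrict j true {b} deg))

  ∂-restrict : ∀ {n} {i j : Fin n} c a → i ≢ j → restrict j c (∂ i a) ≗ ∂ i (restrict j c a)
  ∂-restrict {i = i} {j} c a i≢j S with lookup S i in eqi | lookup S j in eqj
  ... | true | true = refl
  ... | true | false = c*0 c refl (∂-∈ {a = a} (trans (VP.lookup∘update′ i≢j S true) eqi))
  ... | false | true = sym (restrict-∈ {c = c} {b = a} (trans (VP.lookup∘update′ (λ e → i≢j (sym e)) S true) eqj))
  ... | false | false = trans
    (cong (λ z → a (S [ i ]≔ true) + toℤ c * z)
      (trans (∂-∉ {a = a} (trans (VP.lookup∘update′ i≢j S true) eqi)) (cong a (VP.[]≔-commutes S j i (λ e → i≢j (sym e))))))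
    (sym (restrict-∉ {c = c} {b = a} (trans (VP.lookup∘update′ (λ e → i≢j (sym e)) S true) eqj)))

  ev-restrict : ∀ {n} j c (b : Coeffs n) x → ev (restrict j c b) x ≡ ev b (x [ j ]≔ c)
  ev-restrict zero c b (t ∷ x) = begin
    ev (λ S → lo b S + toℤ c * hi b S) x + toℤ t * ev (λ _ → 0ℤ) x
      ≡⟨ cong₂ (λ u v → u + toℤ t * v)
           (trans (ev-cong (λ S → cong (λ z → z + toℤ c * hi b S) (sym (*-identityˡ (lo b S)))) x) (ev-linear 1ℤ (toℤ c) (lo b) (hi b) x))
           (ev-0 (λ _ → refl) x) ⟩
    1ℤ * ev (lo b) x + toℤ c * ev (hi b) x + toℤ t * 0ℤ
      ≡⟨ lem (ev (lo b) x) (ev (hi b) x) (toℤ c) (toℤ t) ⟩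
    ev (lo b) x + toℤ c * ev (hi b) x ∎
    where
    open ≡-Reasoning
    lem : ∀ u v c t → 1ℤ * u + c * v + t * 0ℤ ≡ u + c * v
    lem = solve-∀
  ev-restrict (suc j) c b (t ∷ x) = cong₂ (λ u v → u + toℤ t * v) (ev-restrict j c (lo b) x) (ev-restrict j c (hi b) x)

  ZeroOne-restrict : ∀ {n} j c {a : Coeffs n} → ZeroOne a → ZeroOne (restrict j c a)
  ZeroOne-restrict j c {a} h x rewrite ev-restrict j c a x = h (x [ j ]≔ c)

  -- Energy, edge increments and the Poincaré inequality.

  infixl 6 _⊕_ _⊝_
  _⊕_ _⊝_ : ∀ {n} → Coeffs n → Coeffs n → Coeffs n
  (a ⊕ b) S = a S + b S
  (a ⊝ b) S = a S - b S

  at1 : ∀ {n} → Coeffs (suc n) → Coeffs n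
  at1 a = lo a ⊕ hi a

  -- The sum over the cube of the squared values.
  energy : ∀ {n} → Coeffs n → ℤ
  energy {zero} a = a [] * a []
  energy {suc n} a = energy (lo a) + energy (at1 a)

  -- The sum over the oriented edges of the cube of the squared increments.
  dirichlet : ∀ {n} → Coeffs n → ℤ
  dirichlet {zero} a = 0ℤ
  dirichlet {suc n} a = dirichlet (lo a) + dirichlet (at1 a) + (energy (hi a) + energy (hi a))

  energy-cong : ∀ {n} {a b : Coeffs n} → a ≗ b → energy a ≡ energy b
  energy-cong {zero} e = cong₂ _*_ (e []) (e [])
  energy-cong {suc n} e = cong₂ _+_ (energy-cong (λ S → e (false ∷ S))) (energy-cong (λ S → cong₂ _+_ (e (false ∷ S)) (e (true ∷ S))))

  dirichlet-cong : ∀ {n} {a b : Coeffs n} → a ≗ b → dirichlet a ≡ dirichlet b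
  dirichlet-cong {zero} e = refl
  dirichlet-cong {suc n} e = cong₂ _+_
    (cong₂ _+_ (dirichlet-cong (λ S → e (false ∷ S))) (dirichlet-cong (λ S → cong₂ _+_ (e (false ∷ S)) (e (true ∷ S)))))
    (cong₂ _+_ (energy-cong (λ S → e (true ∷ S))) (energy-cong (λ S → e (true ∷ S))))

  square-nonNeg : ∀ i → 0ℤ ≤ i * i
  square-nonNeg (int n) = subst (0ℤ ≤_) (pos-* n n) (+≤+ ℕ.z≤n)
  square-nonNeg -[1+ n ] = +≤+ ℕ.z≤n

  energy-nonNeg : ∀ {n} (a : Coeffs n) → 0ℤ ≤ energy a
  energy-nonNeg {zero} a = square-nonNeg (a [])
  energy-nonNeg {suc n} a = +-mono-≤ (energy-nonNeg (lo a)) (energy-nonNeg (at1 a))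

  energy-0 : ∀ {n} {a : Coeffs n} → (∀ S → a S ≡ 0ℤ) → energy a ≡ 0ℤ
  energy-0 {zero} z = cong₂ _*_ (z []) (z [])
  energy-0 {suc n} z = cong₂ _+_ (energy-0 (λ S → z (false ∷ S))) (energy-0 (λ S → cong₂ _+_ (z (false ∷ S)) (z (true ∷ S))))

  dirichlet-0 : ∀ {n} {a : Coeffs n} → (∀ S → a S ≡ 0ℤ) → dirichlet a ≡ 0ℤ
  dirichlet-0 {zero} z = refl
  dirichlet-0 {suc n} {a} z = cong₂ _+_
    (cong₂ _+_ (dirichlet-0 (λ S → z (false ∷ S))) (dirichlet-0 (λ S → cong₂ _+_ (z (false ∷ S)) (z (true ∷ S)))))
    (cong₂ _+_ (energy-0 {a = hi a} (λ S → z (true ∷ S))) (energy-0 {a = hi a} (λ S → z (true ∷ S))))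

  exchange-+ : ∀ a b c d → (a + b) + (c + d) ≡ (a + c) + (b + d)
  exchange-+ = solve-∀

  exchange-sub : ∀ a b c d → (a - b) + (c - d) ≡ (a + c) - (b + d)
  exchange-sub = solve-∀

  energy-parallelogram : ∀ {n} (p q : Coeffs n) → energy (p ⊕ q) + energy (p ⊝ q) ≡ (energy p + energy q) + (energy p + energy q)
  energy-parallelogram {zero} p q = lem (p []) (q [])
    where
    lem : ∀ x y → (x + y) * (x + y) + (x - y) * (x - y) ≡ (x * x + y * y) + (x * x + y * y)
    lem = solve-∀
  energy-parallelogram {suc n} p q = begin
    energy (p ⊕ q) + energy (p ⊝ q)
      ≡⟨ cong₂ (λ u v → (energy (lo p ⊕ lo q) + u) + (energy (lo p ⊝ lo q) + v))
           (energy-cong (λ S → exchange-+ (lo p S) (lo q S) (hi p S) (hi q S)))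
           (energy-cong (λ S → exchange-sub (lo p S) (lo q S) (hi p S) (hi q S))) ⟩
    (energy (lo p ⊕ lo q) + energy (at1 p ⊕ at1 q)) + (energy (lo p ⊝ lo q) + energy (at1 p ⊝ at1 q))
      ≡⟨ exchange-+ (energy (lo p ⊕ lo q)) _ _ _ ⟩
    (energy (lo p ⊕ lo q) + energy (lo p ⊝ lo q)) + (energy (at1 p ⊕ at1 q) + energy (at1 p ⊝ at1 q))
      ≡⟨ cong₂ _+_ (energy-parallelogram (lo p) (lo q)) (energy-parallelogram (at1 p) (at1 q)) ⟩
    ((energy (lo p) + energy (lo q)) + (energy (lo p) + energy (lo q))) + ((energy (at1 p) + energy (at1 q)) + (energy (at1 p) + energy (at1 q)))
      ≡⟨ lem (energy (lo p)) (energy (lo q)) (energy (at1 p)) (energy (at1 q)) ⟩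
    (energy p + energy q) + (energy p + energy q) ∎
    where
    open ≡-Reasoning
    lem : ∀ a b c d → ((a + b) + (a + b)) + ((c + d) + (c + d)) ≡ ((a + c) + (b + d)) + ((a + c) + (b + d))
    lem = solve-∀

  dirichlet-parallelogram : ∀ {n} (p q : Coeffs n) →
    dirichlet (p ⊕ q) + dirichlet (p ⊝ q) ≡ (dirichlet p + dirichlet q) + (dirichlet p + dirichlet q)
  dirichlet-parallelogram {zero} p q = refl
  dirichlet-parallelogram {suc n} p q = begin
    dirichlet (p ⊕ q) + dirichlet (p ⊝ q)
      ≡⟨ cong₂ (λ u v → (D (lo p ⊕ lo q) + u + (T (hi p ⊕ hi q) + T (hi p ⊕ hi q))) + (D (lo p ⊝ lo q) + v + (T (hi p ⊝ hi q) + T (hi p ⊝ hi q))))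
           (dirichlet-cong (λ S → exchange-+ (lo p S) (lo q S) (hi p S) (hi q S)))
           (dirichlet-cong (λ S → exchange-sub (lo p S) (lo q S) (hi p S) (hi q S))) ⟩
    (D (lo p ⊕ lo q) + D (at1 p ⊕ at1 q) + (T (hi p ⊕ hi q) + T (hi p ⊕ hi q))) + (D (lo p ⊝ lo q) + D (at1 p ⊝ at1 q) + (T (hi p ⊝ hi q) + T (hi p ⊝ hi q)))
      ≡⟨ lem₁ (D (lo p ⊕ lo q)) (D (at1 p ⊕ at1 q)) (T (hi p ⊕ hi q)) (D (lo p ⊝ lo q)) (D (at1 p ⊝ at1 q)) (T (hi p ⊝ hi q)) ⟩
    (D (lo p ⊕ lo q) + D (lo p ⊝ lo q)) + (D (at1 p ⊕ at1 q) + D (at1 p ⊝ at1 q)) + ((T (hi p ⊕ hi q) + T (hi p ⊝ hi q)) + (T (hi p ⊕ hi q) + T (hi p ⊝ hi q)))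
      ≡⟨ cong₂ _+_ (cong₂ _+_ (dirichlet-parallelogram (lo p) (lo q)) (dirichlet-parallelogram (at1 p) (at1 q)))
                   (cong₂ _+_ (energy-parallelogram (hi p) (hi q)) (energy-parallelogram (hi p) (hi q))) ⟩
    ((D (lo p) + D (lo q)) + (D (lo p) + D (lo q))) + ((D (at1 p) + D (at1 q)) + (D (at1 p) + D (at1 q)))
      + (((T (hi p) + T (hi q)) + (T (hi p) + T (hi q))) + ((T (hi p) + T (hi q)) + (T (hi p) + T (hi q))))
      ≡⟨ lem₂ (D (lo p)) (D (lo q)) (D (at1 p)) (D (at1 q)) (T (hi p)) (T (hi q)) ⟩
    (dirichlet p + dirichlet q) + (dirichlet p + dirichlet q) ∎
    where
    open ≡-Reasoning
    D = dirichlet {n}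
    T = energy {n}
    lem₁ : ∀ a b c d e f → (a + b + (c + c)) + (d + e + (f + f)) ≡ (a + d) + (b + e) + ((c + f) + (c + f))
    lem₁ = solve-∀
    lem₂ : ∀ a b c d e f → ((a + b) + (a + b)) + ((c + d) + (c + d)) + (((e + f) + (e + f)) + ((e + f) + (e + f)))
         ≡ ((a + c + (e + e)) + (b + d + (f + f))) + ((a + c + (e + e)) + (b + d + (f + f)))
    lem₂ = solve-∀

  -- With f₀, f₁ the two restrictions of f in the first variable, f₀ + f₁ has degree at most d and f₁ − f₀
  -- degree at most d − 1; the parallelogram law turns the induction hypothesis for these two into the claim.
  poincaré : ∀ {n d} {a : Coeffs n} → DegreeAtMost a d → dirichlet a ≤ int (4 ℕ.* d) * energy a
  poincaré {zero} {d} {a} deg = subst (_≤ int (4 ℕ.* d) * energy a) (*-zeroʳ (int (4 ℕ.* d)))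
    (*-monoˡ-≤-nonNeg (int (4 ℕ.* d)) (energy-nonNeg a))
  poincaré {suc n} {d} {a} deg = *-cancelˡ-≤-pos _ _ (int 2) (begin
    int 2 * dirichlet a
      ≡⟨ lem₁ (D (lo a)) (D (at1 a)) (T h) ⟩
    (D (at1 a) + D (lo a)) + (D (at1 a) + D (lo a)) + int 4 * T h
      ≡⟨ cong (λ z → z + int 4 * T h) (sym (dirichlet-parallelogram (at1 a) (lo a))) ⟩
    D g + D (at1 a ⊝ lo a) + int 4 * T h
      ≡⟨ cong (λ z → D g + z + int 4 * T h) (dirichlet-cong diff) ⟩
    D g + D h + int 4 * T h
      ≡⟨ +-assoc (D g) (D h) (int 4 * T h) ⟩
    D g + (D h + int 4 * T h)
      ≤⟨ +-mono-≤ (poincaré {a = g} deg-g) (upper d deg) ⟩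
    c * T g + c * T h
      ≡⟨ sym (*-distribˡ-+ c (T g) (T h)) ⟩
    c * (T g + T h)
      ≡⟨ cong (λ z → c * (T g + z)) (sym (energy-cong diff)) ⟩
    c * (T g + T (at1 a ⊝ lo a))
      ≡⟨ cong (c *_) (energy-parallelogram (at1 a) (lo a)) ⟩
    c * ((T (at1 a) + T (lo a)) + (T (at1 a) + T (lo a)))
      ≡⟨ lem₂ c (T (at1 a)) (T (lo a)) ⟩
    int 2 * (c * energy a) ∎)
    where
    open ≤-Reasoning
    D = dirichlet {n}
    T = energy {n}
    c = int (4 ℕ.* d)
    h = hi a
    g = at1 a ⊕ lo a
    lem₁ : ∀ x y z → int 2 * (x + y + (z + z)) ≡ (y + x) + (y + x) + int 4 * z
    lem₁ = solve-∀
    lem₂ : ∀ c x y → c * ((x + y) + (x + y)) ≡ int 2 * (c * (y + x))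
    lem₂ = solve-∀
    diff : at1 a ⊝ lo a ≗ hi a
    diff S = lem (lo a S) (hi a S)
      where
      lem : ∀ x y → x + y - x ≡ y
      lem = solve-∀
    deg-g : DegreeAtMost g d
    deg-g S lt = cong₂ _+_ (cong₂ _+_ (deg (false ∷ S) lt) (deg (true ∷ S) (ℕP.m≤n⇒m≤1+n lt))) (deg (false ∷ S) lt)
    -- `h` has degree at most d - 1, and 4 (d - 1) + 4 = 4 d absorbs the additional `int 4 * T h`;
    -- for d = 0 it vanishes.
    upper : ∀ d → DegreeAtMost a d → D h + int 4 * T h ≤ int (4 ℕ.* d) * T h
    upper zero deg = ≤-reflexive (trans (cong₂ (λ u v → u + int 4 * v) (dirichlet-0 (deg-hi-0 {a = a} deg)) (energy-0 (deg-hi-0 {a = a} deg)))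
      (sym (*-zeroˡ (T h))))
    upper (suc d) deg = begin
      D h + int 4 * T h                     ≤⟨ +-monoˡ-≤ (int 4 * T h) (poincaré {a = h} (deg-hi {a = a} deg)) ⟩
      int (4 ℕ.* d) * T h + int 4 * T h     ≡⟨ sym (*-distribʳ-+ (T h) (int (4 ℕ.* d)) (int 4)) ⟩
      (int (4 ℕ.* d) + int 4) * T h         ≡⟨ cong (λ k → int k * T h) (trans (ℕP.+-comm (4 ℕ.* d) 4) (sym (ℕP.*-suc 4 d))) ⟩
      int (4 ℕ.* suc d) * T h ∎

  int-2^ : ∀ n → int (2 ^ suc n) ≡ int (2 ^ n) + int (2 ^ n)
  int-2^ n = cong (λ k → int (2 ^ n ℕ.+ k)) (ℕP.+-identityʳ (2 ^ n))

  -- A nonzero polynomial of degree at most e is nonzero at no fewer than 2^(n - e) points, and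
  -- there an integer has square at least 1. If both restrictions in the first variable are nonzero,
  -- each contributes half. If one vanishes, the other is `hi b` up to sign and has degree at most e
  -- - 1.
  schwartz-zippel : ∀ {n e} {b : Coeffs n} {S} → b S ≢ 0ℤ → DegreeAtMost b e → int (2 ^ n) ≤ int (2 ^ e) * energy b
  schwartz-zippel {zero} {e} {b} {[]} nz deg = begin
    int 1                       ≤⟨ 1≤square (b []) nz ⟩
    energy b                    ≡⟨ sym (*-identityˡ (energy b)) ⟩
    int 1 * energy b            ≤⟨ *-monoʳ-≤-nonNeg (energy b) {{nonNegative (energy-nonNeg b)}} (+≤+ (2^-mono {0} {e} ℕ.z≤n)) ⟩
    int (2 ^ e) * energy b ∎
    where
    open ≤-Reasoning
    1≤square : ∀ i → i ≢ 0ℤ → int 1 ≤ i * i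
    1≤square (int zero) ne = contradiction refl ne
    1≤square (int (suc n)) ne = +≤+ (ℕ.s≤s ℕ.z≤n)
    1≤square -[1+ n ] ne = +≤+ (ℕ.s≤s ℕ.z≤n)
  schwartz-zippel {suc n} {e} {b} {S} nz deg = cases (top? (lo b)) (top? (at1 b))
    where
    open ≤-Reasoning
    c = int (2 ^ e)
    deg-at1 : DegreeAtMost (at1 b) e
    deg-at1 S lt = cong₂ _+_ (deg (false ∷ S) lt) (deg (true ∷ S) (ℕP.m≤n⇒m≤1+n lt))
    half : ∀ {p : Coeffs n} e → DegreeAtMost b e → (∀ d → DegreeAtMost (hi b) d → DegreeAtMost p d) →
           (∀ S → p S ≢ 0ℤ → hi b S ≢ 0ℤ) → Top p → int (2 ^ suc n) ≤ int (2 ^ e) * energy p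
    half zero deg _ ne (S , nz , _) = contradiction (deg-hi-0 {a = b} deg S) (ne S nz)
    half {p} (suc e) deg f _ (S , nz , _) = begin
      int (2 ^ suc n)                                    ≡⟨ int-2^ n ⟩
      int (2 ^ n) + int (2 ^ n)                          ≤⟨ +-mono-≤ ih ih ⟩
      int (2 ^ e) * energy p + int (2 ^ e) * energy p    ≡⟨ sym (*-distribʳ-+ (energy p) (int (2 ^ e)) (int (2 ^ e))) ⟩
      (int (2 ^ e) + int (2 ^ e)) * energy p             ≡⟨ cong (_* energy p) (sym (int-2^ e)) ⟩
      int (2 ^ suc e) * energy p ∎
      where ih = schwartz-zippel {b = p} nz (f e (deg-hi {a = b} deg))
    cases : (∀ S → lo b S ≡ 0ℤ) ⊎ Top (lo b) → (∀ S → at1 b S ≡ 0ℤ) ⊎ Top (at1 b) → int (2 ^ suc n) ≤ c * energy b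
    cases (inj₂ (S₀ , nz₀ , _)) (inj₂ (S₁ , nz₁ , _)) = begin
      int (2 ^ suc n)                         ≡⟨ int-2^ n ⟩
      int (2 ^ n) + int (2 ^ n)               ≤⟨ +-mono-≤ (schwartz-zippel {b = lo b} nz₀ (deg-lo {a = b} deg)) (schwartz-zippel {b = at1 b} nz₁ deg-at1) ⟩
      c * energy (lo b) + c * energy (at1 b)  ≡⟨ sym (*-distribˡ-+ c (energy (lo b)) (energy (at1 b))) ⟩
      c * energy b ∎
    cases (inj₁ z₀) (inj₂ t₁) = begin
      int (2 ^ suc n)       ≤⟨ half {at1 b} e deg (λ d dg S lt → trans (eq S) (dg S lt)) (λ S ne h → ne (trans (eq S) h)) t₁ ⟩
      c * energy (at1 b)    ≡⟨ cong (c *_) (sym (trans (cong (_+ energy (at1 b)) (energy-0 z₀)) (+-identityˡ _))) ⟩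
      c * energy b ∎
      where
      eq : ∀ S → at1 b S ≡ hi b S
      eq S = trans (cong (_+ hi b S) (z₀ S)) (+-identityˡ (hi b S))
    cases (inj₂ t₀) (inj₁ z₁) = begin
      int (2 ^ suc n)       ≤⟨ half {lo b} e deg (λ d dg S lt → trans (eq S) (cong -_ (dg S lt))) (λ S ne h → ne (trans (eq S) (cong -_ h))) t₀ ⟩
      c * energy (lo b)     ≡⟨ cong (c *_) (sym (trans (cong (λ z → energy (lo b) + z) (energy-0 z₁)) (+-identityʳ _))) ⟩
      c * energy b ∎
      where
      lem : ∀ x y → x ≡ (x + y) - y
      lem = solve-∀
      eq : ∀ S → lo b S ≡ - hi b S
      eq S = trans (lem (lo b S) (hi b S)) (trans (cong (_- hi b S) (z₁ S)) (+-identityˡ _))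
    cases (inj₁ z₀) (inj₁ z₁) = contradiction (zero-everywhere S) nz
      where
      zero-everywhere : ∀ S → b S ≡ 0ℤ
      zero-everywhere (false ∷ S) = z₀ S
      zero-everywhere (true ∷ S) = trans (sym (trans (cong (_+ hi b S) (z₀ S)) (+-identityˡ (hi b S)))) (z₁ S)

  -- For b = `∂ i a`, with a 0/1-valued, the energy is 2ⁿ times the influence of xᵢ and Φ is 2ⁿ⁺¹
  -- times its weight w, so the influence is at least 2 w.
  Φ≤energy : ∀ {n} (b : Coeffs n) → int (Φ b) ≤ energy b
  Φ≤energy {n} b with top? b in eq
  ... | inj₁ z = energy-nonNeg b
  ... | inj₂ (S , nz , deg) = *-cancelˡ-≤-pos _ _ (int (2 ^ size S)) {{positive (+<+ (ℕP.m^n>0 2 (size S)))}}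
    (≤-trans (≤-reflexive (trans (sym (pos-* (2 ^ size S) _)) (cong int (2^-split (size≤n S))))) (schwartz-zippel {b = b} nz deg))

  -- Total influence and total weight.

  ∑ᶠ : ∀ {n} → (Fin n → ℕ) → ℕ
  ∑ᶠ {zero} f = 0
  ∑ᶠ {suc n} f = f zero ℕ.+ ∑ᶠ (λ i → f (suc i))

  ∑ᶻ : ∀ {n} → (Fin n → ℤ) → ℤ
  ∑ᶻ {zero} f = 0ℤ
  ∑ᶻ {suc n} f = f zero + ∑ᶻ (λ i → f (suc i))

  ∑ᶠ≤∑ᶻ : ∀ {n} {f : Fin n → ℕ} {g} → (∀ i → int (f i) ≤ g i) → int (∑ᶠ f) ≤ ∑ᶻ g
  ∑ᶠ≤∑ᶻ {zero} h = ≤-refl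
  ∑ᶠ≤∑ᶻ {suc n} {f} h = ≤-trans (≤-reflexive (pos-+ (f zero) _)) (+-mono-≤ (h zero) (∑ᶠ≤∑ᶻ (λ i → h (suc i))))

  ∑ᶻ-cong : ∀ {n} {f g : Fin n → ℤ} → f ≗ g → ∑ᶻ f ≡ ∑ᶻ g
  ∑ᶻ-cong {zero} h = refl
  ∑ᶻ-cong {suc n} h = cong₂ _+_ (h zero) (∑ᶻ-cong (λ i → h (suc i)))

  ∑ᶻ-+ : ∀ {n} (f g : Fin n → ℤ) → ∑ᶻ (λ i → f i + g i) ≡ ∑ᶻ f + ∑ᶻ g
  ∑ᶻ-+ {zero} f g = refl
  ∑ᶻ-+ {suc n} f g = trans (cong (λ z → f zero + g zero + z) (∑ᶻ-+ (λ i → f (suc i)) (λ i → g (suc i)))) (exchange-+ (f zero) (g zero) _ _)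

  ∂-⊕ : ∀ {n} i (a b : Coeffs n) → ∂ i a ⊕ ∂ i b ≗ ∂ i (a ⊕ b)
  ∂-⊕ i a b S with lookup S i
  ... | true = refl
  ... | false = refl

  -- `∂ i a` does not depend on xᵢ, so an edge in direction i is counted at both of its ends, just
  -- as its two orientations are in `dirichlet`.
  ∑energy-∂ : ∀ {n} (a : Coeffs n) → ∑ᶻ (λ i → energy (∂ i a)) ≡ dirichlet a
  ∑energy-∂ {zero} a = refl
  ∑energy-∂ {suc n} a = begin
    energy (∂ zero a) + ∑ᶻ (λ i → energy (∂ i (lo a)) + energy (∂ i (lo a) ⊕ ∂ i (hi a)))
      ≡⟨ cong₂ _+_ (cong (λ z → energy (hi a) + z) (energy-cong (λ S → +-identityʳ (hi a S))))
           (trans (∑ᶻ-cong (λ i → cong (λ z → energy (∂ i (lo a)) + z) (energy-cong (∂-⊕ i (lo a) (hi a)))))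
                  (∑ᶻ-+ (λ i → energy (∂ i (lo a))) (λ i → energy (∂ i (at1 a))))) ⟩
    energy (hi a) + energy (hi a) + (∑ᶻ (λ i → energy (∂ i (lo a))) + ∑ᶻ (λ i → energy (∂ i (at1 a))))
      ≡⟨ cong (λ z → energy (hi a) + energy (hi a) + z) (cong₂ _+_ (∑energy-∂ (lo a)) (∑energy-∂ (at1 a))) ⟩
    energy (hi a) + energy (hi a) + (dirichlet (lo a) + dirichlet (at1 a))
      ≡⟨ +-comm (energy (hi a) + energy (hi a)) _ ⟩
    dirichlet a ∎
    where open ≡-Reasoning

  one : ∀ {n} → Coeffs n
  one {zero} _ = 1ℤ
  one (false ∷ S) = one S
  one (true ∷ S) = 0ℤ

  ev-one : ∀ {n} (x : Vec Bool n) → ev one x ≡ 1ℤ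
  ev-one [] = refl
  ev-one (b ∷ x) = trans (cong₂ (λ u v → u + toℤ b * v) (ev-one x) (ev-0 (λ _ → refl) x)) (trans (cong (λ z → 1ℤ + z) (*-zeroʳ (toℤ b))) refl)

  deg-one : ∀ {n d} → DegreeAtMost (one {n}) d
  deg-one (true ∷ S) _ = refl
  deg-one (false ∷ S) h = deg-one S h

  spin : ∀ {n} → Coeffs n → Coeffs n
  spin a S = int 2 * a S + - 1ℤ * one S

  energy-scale : ∀ {n} (a : Coeffs n) → energy (λ S → int 2 * a S) ≡ int 4 * energy a
  energy-scale {zero} a = lem (a [])
    where
    lem : ∀ x → int 2 * x * (int 2 * x) ≡ int 4 * (x * x)
    lem = solve-∀
  energy-scale {suc n} a = trans (cong₂ _+_ (energy-scale (lo a))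
    (trans (energy-cong (λ S → sym (*-distribˡ-+ (int 2) (lo a S) (hi a S)))) (energy-scale (at1 a))))
    (sym (*-distribˡ-+ (int 4) (energy (lo a)) (energy (at1 a))))

  dirichlet-spin : ∀ {n} (a : Coeffs n) → dirichlet (spin a) ≡ int 4 * dirichlet a
  dirichlet-spin {zero} a = refl
  dirichlet-spin {suc n} a =
    trans (cong₂ _+_
      (cong₂ _+_ (dirichlet-spin (lo a)) (trans (dirichlet-cong (λ S → lem₁ (lo a S) (one S) (hi a S))) (dirichlet-spin (at1 a))))
      (cong₂ _+_ hi-spin hi-spin))
    (lem₂ (dirichlet (lo a)) (dirichlet (at1 a)) (energy (hi a)))
    where
    lem₁ : ∀ x o y → int 2 * x + - 1ℤ * o + (int 2 * y + - 1ℤ * 0ℤ) ≡ int 2 * (x + y) + - 1ℤ * o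
    lem₁ = solve-∀
    lem₂ : ∀ x y z → int 4 * x + int 4 * y + (int 4 * z + int 4 * z) ≡ int 4 * (x + y + (z + z))
    lem₂ = solve-∀
    hi-spin : energy (hi (spin a)) ≡ int 4 * energy (hi a)
    hi-spin = trans (energy-cong (λ S → +-identityʳ (int 2 * hi a S))) (energy-scale (hi a))

  energy-±1 : ∀ {n} {b : Coeffs n} → (∀ x → ev b x * ev b x ≡ 1ℤ) → energy b ≡ int (2 ^ n)
  energy-±1 {zero} h = h []
  energy-±1 {suc n} {b} h = trans (cong₂ _+_
      (energy-±1 {b = lo b} (λ x → trans (cong (λ z → z * z) (sym (at-false x))) (h (false ∷ x))))
      (energy-±1 {b = at1 b} (λ x → trans (cong (λ z → z * z) (sym (at-true x))) (h (true ∷ x)))))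
    (sym (int-2^ n))
    where
    at-false : ∀ x → ev b (false ∷ x) ≡ ev (lo b) x
    at-false x = trans (cong (λ z → ev (lo b) x + z) (*-zeroˡ (ev (hi b) x))) (+-identityʳ _)
    at-true : ∀ x → ev b (true ∷ x) ≡ ev (at1 b) x
    at-true x = sym (trans (ev-cong (λ S → cong₂ _+_ (sym (*-identityˡ (lo b S))) (sym (*-identityˡ (hi b S)))) x)
      (trans (ev-linear 1ℤ 1ℤ (lo b) (hi b) x) (cong (_+ 1ℤ * ev (hi b) x) (*-identityˡ (ev (lo b) x)))))

  -- Poincaré is applied to the ±1-valued 2f - 1, whose energy is exactly 2ⁿ. Its increments are
  -- twice those of f, and the resulting factor 4 cancels the one in `poincaré`.
  total-influence : ∀ {n d} {a : Coeffs n} → ZeroOne a → DegreeAtMost a d → dirichlet a ≤ int (d ℕ.* 2 ^ n)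
  total-influence {n} {d} {a} 01-valued deg = *-cancelˡ-≤-pos _ _ (int 4) (begin
    int 4 * dirichlet a                  ≡⟨ sym (dirichlet-spin a) ⟩
    dirichlet (spin a)                   ≤⟨ poincaré {a = spin a} deg-spin ⟩
    int (4 ℕ.* d) * energy (spin a)      ≡⟨ cong (int (4 ℕ.* d) *_) (energy-±1 {b = spin a} ±1-valued) ⟩
    int (4 ℕ.* d) * int (2 ^ n)          ≡⟨ sym (pos-* (4 ℕ.* d) (2 ^ n)) ⟩
    int (4 ℕ.* d ℕ.* 2 ^ n)              ≡⟨ cong int (ℕP.*-assoc 4 d (2 ^ n)) ⟩
    int (4 ℕ.* (d ℕ.* 2 ^ n))            ≡⟨ pos-* 4 (d ℕ.* 2 ^ n) ⟩
    int 4 * int (d ℕ.* 2 ^ n) ∎)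
    where
    open ≤-Reasoning
    deg-spin : DegreeAtMost (spin a) d
    deg-spin S h = cong₂ (λ u v → int 2 * u + - 1ℤ * v) (deg S h) (deg-one S h)
    ±1-valued : ∀ x → ev (spin a) x * ev (spin a) x ≡ 1ℤ
    ±1-valued x rewrite ev-linear (int 2) (- 1ℤ) a one x | ev-one x with ev a x | 01-valued x
    ... | _ | inj₁ refl = refl
    ... | _ | inj₂ refl = refl

  weight : ∀ {n} → Coeffs n → ℕ
  weight a = ∑ᶠ (λ i → Φ (∂ i a))

  -- In the scale where `weight` is 2ⁿ⁺¹ W, this is W ≤ d / 2. The energies of the `∂ i a` dominate
  -- the single weights and add up to 2ⁿ times the total influence.
  weight≤degree : ∀ {n d} {a : Coeffs n} → ZeroOne a → DegreeAtMost a d → weight a ℕ.≤ d ℕ.* 2 ^ n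
  weight≤degree {a = a} 01-valued deg = drop‿+≤+ (≤-trans (∑ᶠ≤∑ᶻ (λ i → Φ≤energy (∂ i a)))
    (≤-trans (≤-reflexive (∑energy-∂ a)) (total-influence {a = a} 01-valued deg)))

-- Markov's inequality without the constant, and the number of disjoint sensitive blocks.

module DisjointBlocks where

  open RationalPolynomials
  open IntegerPolynomials
  open import Data.Bool using (Bool; true; false)
  open import Data.Fin using (Fin; zero; suc)
  open import Data.Integer as ℤ using (ℤ; -[1+_]) renaming (+_ to int)
  import Data.Integer.Properties as ℤP
  open import Data.Maybe using (Maybe; just; nothing; maybe′)
  open import Data.Nat as ℕ using (ℕ; zero; suc; _^_)
  import Data.Nat.Properties as ℕP
  open import Data.Nat.Tactic.RingSolver using () renaming (solve-∀ to solveℕ-∀)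
  open import Data.Product using (Σ; _,_; _×_; proj₁; proj₂)
  open import Data.Rational
  open import Data.Rational.Properties
  open import Data.Sum using (inj₁; inj₂)
  open import Data.Vec using (Vec; []; _∷_; lookup; _[_]≔_; map)
  open import Relation.Binary.PropositionalEquality
  open import Relation.Nullary using (yes; no; contradiction)
  open import Tactic.RingSolver using (solve-∀)

  -- Bernoulli's inequality 1 + t / N ≤ (1 + 1 / N)^t with denominators cleared.
  bernoulli-^ : ∀ N t → N ^ t ℕ.* (N ℕ.+ t) ℕ.≤ N ℕ.* suc N ^ t
  bernoulli-^ N zero = ℕP.≤-reflexive (lem N)
    where
    lem : ∀ N → 1 ℕ.* (N ℕ.+ 0) ≡ N ℕ.* 1
    lem = solveℕ-∀
  bernoulli-^ N (suc t) = begin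
    N ℕ.* N ^ t ℕ.* (N ℕ.+ suc t)          ≤⟨ ℕP.m≤m+n _ (N ^ t ℕ.* t) ⟩
    N ℕ.* N ^ t ℕ.* (N ℕ.+ suc t) ℕ.+ N ^ t ℕ.* t ≡⟨ lem₁ N (N ^ t) t ⟩
    suc N ℕ.* (N ^ t ℕ.* (N ℕ.+ t))        ≤⟨ ℕP.*-monoʳ-≤ (suc N) (bernoulli-^ N t) ⟩
    suc N ℕ.* (N ℕ.* suc N ^ t)            ≡⟨ lem₂ N (suc N ^ t) ⟩
    N ℕ.* (suc N ℕ.* suc N ^ t) ∎
    where
    open ℕP.≤-Reasoning
    lem₁ : ∀ N p t → N ℕ.* p ℕ.* (N ℕ.+ suc t) ℕ.+ p ℕ.* t ≡ suc N ℕ.* (p ℕ.* (N ℕ.+ t))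
    lem₁ = solveℕ-∀
    lem₂ : ∀ N p → suc N ℕ.* (N ℕ.* p) ≡ N ℕ.* (suc N ℕ.* p)
    lem₂ = solveℕ-∀

  subexponential : ∀ {k N} → 0 ℕ.< N → (∀ t → k ^ t ℕ.≤ 4 ℕ.* N ^ t) → k ℕ.≤ N
  subexponential {k} {N} N>0 h with k ℕP.≤? N
  ... | yes k≤N = k≤N
  ... | no k≰N = contradiction (ℕP.≤-trans (bernoulli-^ N t) (begin
      N ℕ.* suc N ^ t        ≤⟨ ℕP.*-monoʳ-≤ N (ℕP.≤-trans (ℕP.^-monoˡ-≤ t (ℕP.≰⇒> k≰N)) (h t)) ⟩
      N ℕ.* (4 ℕ.* N ^ t)    ≡⟨ lem N (N ^ t) ⟩
      N ^ t ℕ.* t ∎))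
    (ℕP.<⇒≱ (ℕP.*-monoʳ-< (N ^ t) {{ℕP.m^n≢0 N t {{ℕ.>-nonZero N>0}}}} (ℕP.m<n+m t N>0)))
    where
    open ℕP.≤-Reasoning
    -- For k ≥ N + 1 the hypothesis gives (1 + 1 / N)^t ≤ 4, while Bernoulli gives at least 5 at
    -- this t.
    t = 4 ℕ.* N
    lem : ∀ N p → N ℕ.* (4 ℕ.* p) ≡ p ℕ.* (4 ℕ.* N)
    lem = solveℕ-∀

  -- A polynomial q(x) = x r(x) of degree D that maps [0, 1] into itself and has slope k at 0.
  -- Composition multiplies both degrees and slopes.
  record Contact (D : ℕ) (k : ℕ) : Set where
    constructor contact
    field
      {e} : ℕ
      {r} : ℚ → ℚ
      degree : suc e ≡ D
      poly   : Poly e r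
      slope  : r 0ℚ ≡ ι k
      bounded : UnitBounded (λ x → x * r x)

  -- With q(x) = x r(x), the composite q′(q(x)) is x times r(x) r′(x r(x)), whose value at 0 is the
  -- product of the slopes.
  contact-∘ : ∀ {D k D′ k′} → Contact D k → Contact D′ k′ → Contact (D ℕ.* D′) (k ℕ.* k′)
  contact-∘ {k = k} {k′ = k′} (contact {e} {r} refl P s b) (contact {e′} {r′} refl P′ s′ b′) =
    contact {r = λ x → r x * r′ (x * r x)} (lem e e′) (poly-* P (poly-∘ P′ (poly-x P)))
      (trans (cong₂ (λ u v → u * r′ v) s (*-zeroˡ (r 0ℚ))) (trans (cong (ι k *_) s′) (sym (ι-* k k′))))
      λ x x≥0 x≤1 → let (l , u) = b x x≥0 x≤1; (l′ , u′) = b′ (x * r x) l u; eq = *-assoc x (r x) (r′ (x * r x))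
                    in subst (0ℚ ≤_) eq l′ , subst (_≤ 1ℚ) eq u′
    where
    lem : ∀ e e′ → suc (e ℕ.+ e′ ℕ.* suc e) ≡ suc e ℕ.* suc e′
    lem = solveℕ-∀

  contact-^ : ∀ {D k} → Contact D k → ∀ t → Contact (D ^ t) (k ^ t)
  contact-^ c zero = contact {r = λ _ → 1ℚ} refl (const 1ℚ (λ _ → refl)) refl
    λ x x≥0 x≤1 → subst (0ℚ ≤_) (sym (*-identityʳ x)) x≥0 , subst (_≤ 1ℚ) (sym (*-identityʳ x)) x≤1
  contact-^ c (suc t) = contact-∘ c (contact-^ c t)

  contact-weak : ∀ {D k} → Contact D k → k ℕ.≤ 4 ℕ.* (D ℕ.* D)
  contact-weak (contact refl P s b) = ι-cancel-≤ (subst (_≤ _) s (Markov.markov P b))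

  -- Iterating t times turns k ≤ 4 D² into k ^ t ≤ 4 D ^ 2t, and the constant 4 disappears as t grows.
  contact-bound : ∀ {D k} → 0 ℕ.< D → Contact D k → k ℕ.≤ D ℕ.* D
  contact-bound {D} {k} D>0 c = subexponential (ℕP.*-mono-< D>0 D>0) λ t →
    ℕP.≤-trans (contact-weak (contact-^ c t)) (ℕP.≤-reflexive (cong (4 ℕ.*_) (sym (^-distribʳ-* t))))
    where
    lem : ∀ a b c d → a ℕ.* b ℕ.* (c ℕ.* d) ≡ a ℕ.* c ℕ.* (b ℕ.* d)
    lem = solveℕ-∀
    ^-distribʳ-* : ∀ t → (D ℕ.* D) ^ t ≡ D ^ t ℕ.* D ^ t
    ^-distribʳ-* zero = refl
    ^-distribʳ-* (suc t) = trans (cong (D ℕ.* D ℕ.*_) (^-distribʳ-* t)) (lem D D (D ^ t) (D ^ t))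

  -- Mean values under independent flips.

  κ : ℤ → ℚ
  κ (int n) = ι n
  κ -[1+ n ] = - ι (suc n)

  κ-⊖ : ∀ m n → κ (m ℤ.⊖ n) ≡ ι m - ι n
  κ-⊖ m zero = sym (+-identityʳ (ι m))
  κ-⊖ zero (suc n) = sym (+-identityˡ _)
  κ-⊖ (suc m) (suc n) = trans (cong κ (ℤP.[1+m]⊖[1+n]≡m⊖n m n)) (trans (κ-⊖ m n) (lem (ι m) (ι n)))
    where
    lem : ∀ m n → m - n ≡ 1ℚ + m - (1ℚ + n)
    lem = solve-∀ ℚ-ring

  κ-+ : ∀ i j → κ (i ℤ.+ j) ≡ κ i + κ j
  κ-+ (int m) (int n) = ι-+ m n
  κ-+ (int m) -[1+ n ] = κ-⊖ m (suc n)
  κ-+ -[1+ m ] (int n) = trans (κ-⊖ n (suc m)) (+-comm (ι n) _)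
  κ-+ -[1+ m ] -[1+ n ] = trans (cong (λ z → - (1ℚ + (1ℚ + z))) (ι-+ m n)) (lem (ι m) (ι n))
    where
    lem : ∀ m n → - (1ℚ + (1ℚ + (m + n))) ≡ - (1ℚ + m) + - (1ℚ + n)
    lem = solve-∀ ℚ-ring

  -- The mean of g when every coordinate is 1 independently with probability t.
  𝔼 : ∀ {k} → (Vec Bool k → ℚ) → ℚ → ℚ
  𝔼 {zero} g t = g []
  𝔼 {suc k} g t = (1ℚ - t) * 𝔼 (λ y → g (false ∷ y)) t + t * 𝔼 (λ y → g (true ∷ y)) t

  𝔼-cong : ∀ {k} {g h : Vec Bool k → ℚ} → g ≗ h → 𝔼 g ≗ 𝔼 h
  𝔼-cong {zero} e t = e []
  𝔼-cong {suc k} e t = cong₂ (λ u v → (1ℚ - t) * u + t * v) (𝔼-cong (λ y → e (false ∷ y)) t) (𝔼-cong (λ y → e (true ∷ y)) t)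

  𝔼-+ : ∀ {k} (g h : Vec Bool k → ℚ) t → 𝔼 (λ y → g y + h y) t ≡ 𝔼 g t + 𝔼 h t
  𝔼-+ {zero} g h t = refl
  𝔼-+ {suc k} g h t =
    trans (cong₂ (λ u v → (1ℚ - t) * u + t * v) (𝔼-+ (λ y → g (false ∷ y)) _ t) (𝔼-+ (λ y → g (true ∷ y)) _ t))
          (lem (1ℚ - t) t _ _ _ _)
    where
    lem : ∀ s t a b c d → s * (a + b) + t * (c + d) ≡ s * a + t * c + (s * b + t * d)
    lem = solve-∀ ℚ-ring

  𝔼-scale : ∀ {k} c (g : Vec Bool k → ℚ) t → 𝔼 (λ y → c * g y) t ≡ c * 𝔼 g t
  𝔼-scale {zero} c g t = refl
  𝔼-scale {suc k} c g t =
    trans (cong₂ (λ u v → (1ℚ - t) * u + t * v) (𝔼-scale c (λ y → g (false ∷ y)) t) (𝔼-scale c (λ y → g (true ∷ y)) t))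
          (lem (1ℚ - t) t c _ _)
    where
    lem : ∀ s t c a b → s * (c * a) + t * (c * b) ≡ c * (s * a + t * b)
    lem = solve-∀ ℚ-ring

  𝔼-const : ∀ {k} c t → 𝔼 {k} (λ _ → c) t ≡ c
  𝔼-const {zero} c t = refl
  𝔼-const {suc k} c t = trans (cong₂ (λ u v → (1ℚ - t) * u + t * v) (𝔼-const {k} c t) (𝔼-const {k} c t)) (lem t c)
    where
    lem : ∀ t c → (1ℚ - t) * c + t * c ≡ c
    lem = solve-∀ ℚ-ring

  𝔼-bounded : ∀ {k} {g : Vec Bool k → ℚ} → (∀ y → 0ℚ ≤ g y × g y ≤ 1ℚ) → UnitBounded (𝔼 g)
  𝔼-bounded {zero} h t t≥0 t≤1 = h []
  𝔼-bounded {suc k} {g} h t t≥0 t≤1 =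
    let (l , u) = 𝔼-bounded (λ y → h (false ∷ y)) t t≥0 t≤1
        (l′ , u′) = 𝔼-bounded (λ y → h (true ∷ y)) t t≥0 t≤1
        s≥0 = ≤⇒0≤- t≤1
    in 0≤+ (0≤* s≥0 l) (0≤* t≥0 l′) ,
       subst (𝔼 g t ≤_) (lem t) (+-mono-≤ (*-monoˡ-≤ s≥0 u) (*-monoˡ-≤ t≥0 u′))
    where
    lem : ∀ t → (1ℚ - t) * 1ℚ + t * 1ℚ ≡ 1ℚ
    lem = solve-∀ ℚ-ring

  -- The derivative of `𝔼 g` at 0, namely the sum of the increments of g from `∅` to the unit
  -- vectors.
  slopeAt∅ : ∀ {k} → (Vec Bool k → ℚ) → ℚ
  slopeAt∅ {zero} g = 0ℚ
  slopeAt∅ {suc k} g = slopeAt∅ (λ y → g (false ∷ y)) + (g (true ∷ ∅) - g (false ∷ ∅))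

  -- This exhibits the slope at 0, but bounds the degree by the number of coordinates only. The
  -- bound by the degree of f comes from `𝔼-spread-poly`.
  𝔼-taylor : ∀ {k} (g : Vec Bool k → ℚ) → Σ (ℚ → ℚ) λ z → Poly k z ×
             (∀ t → 𝔼 g t ≡ g ∅ + t * (slopeAt∅ g + t * z t))
  𝔼-taylor {zero} g = (λ _ → 0ℚ) , const 0ℚ (λ _ → refl) , lem (g [])
    where
    lem : ∀ c t → c ≡ c + t * (0ℚ + t * 0ℚ)
    lem = solve-∀ ℚ-ring
  𝔼-taylor {suc k} g with 𝔼-taylor (λ y → g (false ∷ y)) | 𝔼-taylor (λ y → g (true ∷ y))
  ... | z₀ , P₀ , e₀ | z₁ , P₁ , e₁ =
    (λ t → (z₀ t + (s₁ + - 1ℚ * s₀)) + t * (z₁ t + - 1ℚ * z₀ t)) ,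
    poly-+ (poly-+ (poly-weaken (ℕP.n≤1+n k) P₀) (const (s₁ + - 1ℚ * s₀) (λ _ → refl)))
           (poly-x (poly-+ P₁ (poly-scale (- 1ℚ) P₀))) ,
    λ t → trans (cong₂ (λ u v → (1ℚ - t) * u + t * v) (e₀ t) (e₁ t))
                (lem t (g (false ∷ ∅)) s₀ (z₀ t) (g (true ∷ ∅)) s₁ (z₁ t))
    where
    s₀ = slopeAt∅ (λ y → g (false ∷ y))
    s₁ = slopeAt∅ (λ y → g (true ∷ y))
    lem : ∀ t a s z b u w → (1ℚ - t) * (a + t * (s + t * z)) + t * (b + t * (u + t * w))
        ≡ a + t * (s + (b - a) + t * ((z + (u + - 1ℚ * s)) + t * (w + - 1ℚ * z)))
    lem = solve-∀ ℚ-ring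

  unit : ∀ {k} → Fin k → Vec Bool k
  unit i = ∅ [ i ]≔ true

  slopeAt∅-count : ∀ {k} {g : Vec Bool k → ℚ} → (∀ i → g (unit i) - g ∅ ≡ 1ℚ) → slopeAt∅ g ≡ ι k
  slopeAt∅-count {zero} h = refl
  slopeAt∅-count {suc k} h = trans (cong₂ _+_ (slopeAt∅-count (λ i → h (suc i))) (h zero)) (+-comm (ι k) 1ℚ)

  -- `poly-÷x` yields a quotient of `𝔼 g` by x with the right degree, and `𝔼-taylor` one whose value
  -- at 0 is k. They agree at the positive integers, where x can be cancelled, and hence at 0 by
  -- `poly-0-at-0`. So the first quotient is a contact of slope k.
  mean-bound : ∀ {d k} (g : Vec Bool k → ℚ) → Poly (suc d) (𝔼 g) → (∀ y → 0ℚ ≤ g y × g y ≤ 1ℚ) →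
               g ∅ ≡ 0ℚ → (∀ i → g (unit i) ≡ 1ℚ) → k ℕ.≤ suc d ℕ.* suc d
  mean-bound {d} {k} g P b g∅ g1 = contact-bound (ℕ.s≤s ℕ.z≤n)
      (contact refl (proj₁ (proj₂ quot)) slope (λ x x≥0 x≤1 →
        let (l , u) = 𝔼-bounded b x x≥0 x≤1 in subst (0ℚ ≤_) (qeq x) l , subst (_≤ 1ℚ) (qeq x) u))
    where
    z = proj₁ (𝔼-taylor g)
    taylor : ∀ t → 𝔼 g t ≡ t * (ι k + t * z t)
    taylor t = trans (proj₂ (proj₂ (𝔼-taylor g)) t) (trans (cong₂ (λ u v → u + t * (v + t * z t)) g∅
      (slopeAt∅-count (λ i → cong₂ _-_ (g1 i) g∅))) (+-identityˡ _))
    quot = poly-÷x P (trans (taylor 0ℚ) (*-zeroˡ (ι k + 0ℚ * z 0ℚ)))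
    r = proj₁ quot
    qeq : ∀ x → 𝔼 g x ≡ x * r x
    qeq = proj₂ (proj₂ quot)
    diff : ℚ → ℚ
    diff x = r x + - 1ℚ * (ι k + x * z x)
    diff-poly : Poly (d ℕ.+ suc k) diff
    diff-poly = poly-+ (poly-weaken (ℕP.m≤m+n d (suc k)) (proj₁ (proj₂ quot)))
      (poly-scale (- 1ℚ) (poly-weaken (ℕP.m≤n+m (suc k) d) (poly-+ (const (ι k) (λ _ → refl)) (poly-x (proj₁ (proj₂ (𝔼-taylor g)))))))
    diff-0 : ∀ i → diff (ι (suc i)) ≡ 0ℚ
    diff-0 i = begin
      r x + - 1ℚ * u                    ≡⟨ sym (*-identityˡ _) ⟩
      1ℚ * (r x + - 1ℚ * u)             ≡⟨ cong (_* (r x + - 1ℚ * u)) (sym (inv-inverse i)) ⟩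
      x * inv i * (r x + - 1ℚ * u)      ≡⟨ lem x (inv i) (r x) u ⟩
      inv i * (x * r x - x * u)         ≡⟨ cong (λ w → inv i * (w - x * u)) (trans (sym (qeq x)) (taylor x)) ⟩
      inv i * (x * u - x * u)           ≡⟨ cong (inv i *_) (+-inverseʳ (x * u)) ⟩
      inv i * 0ℚ                        ≡⟨ *-zeroʳ (inv i) ⟩
      0ℚ ∎
      where
      open ≡-Reasoning
      x = ι (suc i)
      u = ι k + x * z x
      lem : ∀ x v r u → x * v * (r + - 1ℚ * u) ≡ v * (x * r - x * u)
      lem = solve-∀ ℚ-ring
    slope : r 0ℚ ≡ ι k
    slope = trans (lem (r 0ℚ) (ι k) (z 0ℚ)) (trans (cong (_+ ι k) (poly-0-at-0 diff-poly diff-0)) (+-identityˡ (ι k)))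
      where
      lem : ∀ r k z → r ≡ r + - 1ℚ * (k + 0ℚ * z) + k
      lem = solve-∀ ℚ-ring

  toℚ : Bool → ℚ
  toℚ true = 1ℚ
  toℚ false = 0ℚ

  κ-toℤ* : ∀ b i → κ (toℤ b ℤ.* i) ≡ toℚ b * κ i
  κ-toℤ* true i = trans (cong κ (ℤP.*-identityˡ i)) (sym (*-identityˡ (κ i)))
  κ-toℤ* false i = trans (cong κ (ℤP.*-zeroˡ i)) (sym (*-zeroˡ (κ i)))

  χ : ∀ {k} → Vec Bool k → Vec Bool k → ℚ
  χ [] [] = 1ℚ
  χ (false ∷ T) (_ ∷ y) = χ T y
  χ (true ∷ T) (b ∷ y) = toℚ b * χ T y

  χ-∅ : ∀ {k} (y : Vec Bool k) → χ ∅ y ≡ 1ℚ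
  χ-∅ [] = refl
  χ-∅ (b ∷ y) = χ-∅ y

  χ-insert : ∀ {k} (T : Vec Bool k) i y → χ (T [ i ]≔ true) y ≡ toℚ (lookup y i) * χ T y
  χ-insert (false ∷ T) zero (b ∷ y) = refl
  χ-insert (true ∷ T) zero (true ∷ y) = sym (*-identityˡ _)
  χ-insert (true ∷ T) zero (false ∷ y) = trans (*-zeroˡ (χ T y)) (sym (*-zeroˡ (0ℚ * χ T y)))
  χ-insert (false ∷ T) (suc i) (b ∷ y) = χ-insert T i y
  χ-insert (true ∷ T) (suc i) (b ∷ y) =
    trans (cong (toℚ b *_) (χ-insert T i y)) (lem (toℚ b) (toℚ (lookup y i)) (χ T y))
    where
    lem : ∀ a b c → a * (b * c) ≡ b * (a * c)
    lem = solve-∀ ℚ-ring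

  size-insert : ∀ {k} (T : Vec Bool k) i → size (T [ i ]≔ true) ℕ.≤ suc (size T)
  size-insert (false ∷ T) zero = ℕP.≤-refl
  size-insert (true ∷ T) zero = ℕP.n≤1+n _
  size-insert (false ∷ T) (suc i) = size-insert T i
  size-insert (true ∷ T) (suc i) = ℕ.s≤s (size-insert T i)

  -- By independence the mean is t to the power `size T`.
  𝔼-χ : ∀ {k} (T : Vec Bool k) → Poly (size T) (𝔼 (χ T))
  𝔼-χ [] = const 1ℚ (λ _ → refl)
  𝔼-χ (false ∷ T) = poly-≗ (λ t → lem t (𝔼 (χ T) t)) (𝔼-χ T)
    where
    lem : ∀ t x → (1ℚ - t) * x + t * x ≡ x
    lem = solve-∀ ℚ-ring
  𝔼-χ {suc k} (true ∷ T) = poly-≗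
    (λ t → trans (cong₂ (λ u v → (1ℚ - t) * u + t * v) (𝔼-scale 0ℚ (χ T) t) (𝔼-scale 1ℚ (χ T) t)) (lem t (𝔼 (χ T) t)))
    (poly-x (𝔼-χ T))
    where
    lem : ∀ t x → (1ℚ - t) * (0ℚ * x) + t * (1ℚ * x) ≡ t * x
    lem = solve-∀ ℚ-ring

  -- The substitution sending every variable owned by block i to yᵢ, and the unowned ones to 0.
  spread : ∀ {n k} → Vec (Maybe (Fin k)) n → Vec Bool k → Vec Bool n
  spread o y = map (maybe′ (lookup y) false) o

  -- T collects the blocks met so far by a monomial. A variable owned by block i contributes the
  -- factor yᵢ, and yᵢ² = yᵢ, so T grows by at most one element while `hi a` loses one degree: the
  -- sum `size T + d` never increases.
  𝔼-spread-poly : ∀ {n k d} {a : Coeffs n} (o : Vec (Maybe (Fin k)) n) (T : Vec Bool k) → DegreeAtMost a d →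
                  Poly (size T ℕ.+ d) (𝔼 (λ y → χ T y * κ (ev a (spread o y))))
  𝔼-spread-poly {d = d} {a = a} [] T deg = poly-≗
    (λ t → trans (𝔼-cong (λ y → *-comm (χ T y) (κ (a []))) t) (𝔼-scale (κ (a [])) (χ T) t))
    (poly-weaken (ℕP.m≤m+n (size T) d) (poly-scale (κ (a [])) (𝔼-χ T)))
  𝔼-spread-poly {a = a} (nothing ∷ o) T deg =
    poly-≗ (𝔼-cong (λ y → cong (λ z → χ T y * κ z) (trans (cong (λ v → ev (lo a) (spread o y) ℤ.+ v) (ℤP.*-zeroˡ (ev (hi a) (spread o y)))) (ℤP.+-identityʳ (ev (lo a) (spread o y))))))
           (𝔼-spread-poly o T (deg-lo {a = a} deg))
  𝔼-spread-poly {k = k} {d} {a} (just i ∷ o) T deg =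
    poly-≗ (λ t → trans (𝔼-cong expand t) (𝔼-+ (λ y → χ T y * κ (ev (lo a) (spread o y))) _ t))
           (poly-+ (𝔼-spread-poly o T (deg-lo {a = a} deg)) (upper d deg))
    where
    lem : ∀ c u b v → c * (u + b * v) ≡ c * u + b * c * v
    lem = solve-∀ ℚ-ring
    expand : ∀ y → χ T y * κ (ev a (spread (just i ∷ o) y))
           ≡ χ T y * κ (ev (lo a) (spread o y)) + χ (T [ i ]≔ true) y * κ (ev (hi a) (spread o y))
    expand y = begin
      χ T y * κ (u ℤ.+ toℤ b ℤ.* v)        ≡⟨ cong (χ T y *_) (κ-+ u (toℤ b ℤ.* v)) ⟩
      χ T y * (κ u + κ (toℤ b ℤ.* v))      ≡⟨ cong (λ z → χ T y * (κ u + z)) (κ-toℤ* b v) ⟩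
      χ T y * (κ u + toℚ b * κ v)          ≡⟨ lem (χ T y) (κ u) (toℚ b) (κ v) ⟩
      χ T y * κ u + toℚ b * χ T y * κ v    ≡⟨ cong (λ z → χ T y * κ u + z * κ v) (sym (χ-insert T i y)) ⟩
      χ T y * κ u + χ (T [ i ]≔ true) y * κ v ∎
      where
      open ≡-Reasoning
      b = lookup y i
      u = ev (lo a) (spread o y)
      v = ev (hi a) (spread o y)
    upper : ∀ d → DegreeAtMost a d → Poly (size T ℕ.+ d) (𝔼 (λ y → χ (T [ i ]≔ true) y * κ (ev (hi a) (spread o y))))
    upper zero deg = const 0ℚ (λ t → trans (𝔼-cong
      (λ y → trans (cong (λ z → χ (T [ i ]≔ true) y * κ z) (ev-0 (deg-hi-0 {a = a} deg) (spread o y))) (*-zeroʳ (χ (T [ i ]≔ true) y))) t) (𝔼-const {k} 0ℚ t))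
    upper (suc d) deg = poly-weaken
      (ℕP.≤-trans (ℕP.+-monoˡ-≤ d (size-insert T i)) (ℕP.≤-reflexive (sym (ℕP.+-suc (size T) d))))
      (𝔼-spread-poly o (T [ i ]≔ true) (deg-hi {a = a} deg))

  -- Every variable has at most one owner in `o`, which makes the blocks disjoint. If f(0) = 1, then
  -- 1 - f replaces f, so that g starts at 0 and all k increments are + 1.
  block-bound : ∀ {n k d} {a : Coeffs n} → ZeroOne a → DegreeAtMost a (suc d) → (o : Vec (Maybe (Fin k)) n) →
                (∀ i → ev a (spread o (unit i)) ≢ ev a (spread o ∅)) → k ℕ.≤ suc d ℕ.* suc d
  block-bound {n} {k} {d} {a} 01-valued deg o sens with 01-valued (spread o ∅)
  ... | inj₁ e₀ = mean-bound g P bnd (cong κ e₀) at-unit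
    where
    g : Vec Bool k → ℚ
    g y = κ (ev a (spread o y))
    P : Poly (suc d) (𝔼 g)
    P = subst (λ m → Poly (m ℕ.+ suc d) (𝔼 g)) (size-∅ k)
      (poly-≗ (𝔼-cong (λ y → sym (trans (cong (_* g y) (χ-∅ y)) (*-identityˡ (g y))))) (𝔼-spread-poly o ∅ deg))
    bnd : ∀ y → 0ℚ ≤ g y × g y ≤ 1ℚ
    bnd y with ev a (spread o y) | 01-valued (spread o y)
    ... | _ | inj₁ refl = ≤-refl , 0≤1
    ... | _ | inj₂ refl = 0≤1 , ≤-refl
    at-unit : ∀ i → g (unit i) ≡ 1ℚ
    at-unit i with 01-valued (spread o (unit i))
    ... | inj₁ e = contradiction (trans e (sym e₀)) (sens i)
    ... | inj₂ e = cong κ e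
  ... | inj₂ e₁ = mean-bound g P bnd (cong (λ z → 1ℚ + - 1ℚ * κ z) e₁) at-unit
    where
    f g : Vec Bool k → ℚ
    f y = κ (ev a (spread o y))
    g y = 1ℚ + - 1ℚ * f y
    P : Poly (suc d) (𝔼 g)
    P = poly-≗ (λ t → trans (𝔼-+ (λ _ → 1ℚ) (λ y → - 1ℚ * f y) t) (cong₂ _+_ (𝔼-const {k} 1ℚ t) (𝔼-scale (- 1ℚ) f t)))
      (poly-+ (const 1ℚ (λ _ → refl)) (poly-scale (- 1ℚ) (subst (λ m → Poly (m ℕ.+ suc d) (𝔼 f)) (size-∅ k)
        (poly-≗ (𝔼-cong (λ y → sym (trans (cong (_* f y) (χ-∅ y)) (*-identityˡ (f y))))) (𝔼-spread-poly o ∅ deg)))))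
    bnd : ∀ y → 0ℚ ≤ g y × g y ≤ 1ℚ
    bnd y with ev a (spread o y) | 01-valued (spread o y)
    ... | _ | inj₁ refl = 0≤1 , ≤-refl
    ... | _ | inj₂ refl = ≤-refl , 0≤1
    at-unit : ∀ i → g (unit i) ≡ 1ℚ
    at-unit i with 01-valued (spread o (unit i))
    ... | inj₁ e = cong (λ z → 1ℚ + - 1ℚ * κ z) e
    ... | inj₂ e = contradiction (trans e (sym e₁)) (sens i)

open IntegerPolynomials
open DisjointBlocks using (unit; spread; block-bound)
open import Data.Bool using (Bool; true; false; if_then_else_; _∨_)
import Data.Bool.Properties as BP
open import Data.Fin using (Fin; zero; suc; splitAt)
import Data.Fin.Properties as FP
open import Data.Integer as ℤ using (ℤ; 0ℤ; 1ℤ)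
import Data.Integer.Properties as ℤP
open import Data.Integer.Tactic.RingSolver using () renaming (solve-∀ to solveℤ-∀)
open import Data.List as List using (List; []; _∷_; filter; allFin; tabulate; length)
import Data.List.Properties as LP
open import Data.List.Membership.Propositional using (_∈_; lose)
open import Data.List.Membership.Propositional.Properties using (∈-filter⁺; ∈-allFin; ∈-++⁺ˡ; ∈-++⁺ʳ; ∈-map⁺)
open import Data.List.Relation.Unary.All using (All; []; _∷_; universal)
import Data.List.Relation.Unary.All.Properties as AllP
open import Data.List.Relation.Unary.Any using (Any; here; there; satisfied)
open import Data.Maybe as Maybe using (Maybe; just; nothing)
open import Data.Nat as ℕ using (ℕ; zero; suc; _+_; _*_; _∸_; _^_; _≤_; _<_)
import Data.Nat.Properties as ℕP
open import Data.Nat.Tactic.RingSolver using (solve-∀)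
open import Data.Product using (Σ; _,_; _×_; proj₁; proj₂; ∃)
open import Data.Sum using (_⊎_; inj₁; inj₂; [_,_]′)
open import Data.Unit using (tt)
open import Data.Vec using (Vec; []; _∷_; lookup; _[_]≔_; replicate; zipWith; _++_)
import Data.Vec.Properties as VP
open import Relation.Binary.PropositionalEquality
open import Relation.Nullary using (Dec; yes; no; contradiction; ¬_; ¬?)
open import Relation.Nullary.Decidable using (_×-dec_)
open import Relation.Unary using (Decidable)

-- Sensitive blocks inside monomials and maximal disjoint families.

_⊑_ : ∀ {n} → Vec Bool n → Vec Bool n → Set
B ⊑ M = ∀ v → lookup B v ≡ true → lookup M v ≡ true

⊑-∷ : ∀ {n c} {B M : Vec Bool n} → B ⊑ M → (c ∷ B) ⊑ (true ∷ M)
⊑-∷ h zero e = refl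
⊑-∷ h (suc v) e = h v e

⊑-false : ∀ {n c} {B M : Vec Bool n} → B ⊑ M → (false ∷ B) ⊑ (c ∷ M)
⊑-false h (suc v) e = h v e

ev-false : ∀ {n} (a : Coeffs (suc n)) x → ev a (false ∷ x) ≡ ev (lo a) x
ev-false a x = trans (cong (λ z → ev (lo a) x ℤ.+ z) (ℤP.*-zeroˡ (ev (hi a) x))) (ℤP.+-identityʳ _)

ev-true≢false : ∀ {n} (a : Coeffs (suc n)) x → ev (hi a) x ≢ 0ℤ → ev a (true ∷ x) ≢ ev a (false ∷ x)
ev-true≢false a x ne e = ne (trans (lem (ev (lo a) x) (ev (hi a) x)) (ℤP.i≡j⇒i-j≡0 e))
  where
  lem : ∀ u v → v ≡ (u ℤ.+ ℤ.1ℤ ℤ.* v) ℤ.- (u ℤ.+ 0ℤ ℤ.* v)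
  lem = solveℤ-∀

distinct : ∀ {n} (a : Coeffs n) x y z → ev a x ≢ ev a y → ev a x ≢ z ⊎ ev a y ≢ z
distinct a x y z ne with ev a x ℤP.≟ z
... | no ne′ = inj₁ ne′
... | yes e = inj₂ λ e′ → ne (trans e (sym e′))

-- Variables outside M are set to 0. At a variable of M, a point where `hi a` is nonzero has two
-- extensions with different values, so one of these is nonzero.
nonvanishing-point : ∀ {n} (a : Coeffs n) M → a M ≢ 0ℤ → Σ (Vec Bool n) λ B → B ⊑ M × ev a B ≢ 0ℤ
nonvanishing-point a [] ne = [] , (λ ()) , ne
nonvanishing-point a (false ∷ M) ne with nonvanishing-point (lo a) M ne
... | B , sub , ne′ = false ∷ B , ⊑-false sub , λ e → ne′ (trans (sym (ev-false a B)) e)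
nonvanishing-point a (true ∷ M) ne with nonvanishing-point (hi a) M ne
... | B , sub , ne′ = [ (λ h → true ∷ B , ⊑-∷ sub , h) , (λ h → false ∷ B , ⊑-∷ sub , h) ]′
                        (distinct a (true ∷ B) (false ∷ B) 0ℤ (ev-true≢false a B ne′))

-- At the first variable of M, two points inside M have different values, and these cannot both be
-- the value at `∅`.
sensitive-block : ∀ {n} (a : Coeffs n) M → 0 < size M → a M ≢ 0ℤ → Σ (Vec Bool n) λ B → B ⊑ M × ev a B ≢ ev a ∅
sensitive-block a (false ∷ M) pos ne with sensitive-block (lo a) M pos ne
... | B , sub , ne′ = false ∷ B , ⊑-false sub , λ e → ne′ (trans (sym (ev-false a B)) (trans e (ev-false a ∅)))
sensitive-block a (true ∷ M) pos ne with nonvanishing-point (hi a) M ne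
... | B , sub , ne′ = [ (λ h → true ∷ B , ⊑-∷ sub , h) , (λ h → false ∷ B , ⊑-∷ sub , h) ]′
                        (distinct a (true ∷ B) (false ∷ B) (ev a ∅) (ev-true≢false a B ne′))

prependBlock : ∀ {n k} → Vec Bool n → Vec (Maybe (Fin k)) n → Vec (Maybe (Fin (suc k))) n
prependBlock = zipWith (λ b x → if b then just zero else Maybe.map suc x)

spread-∅ : ∀ {n k} (o : Vec (Maybe (Fin k)) n) → spread o ∅ ≡ ∅
spread-∅ [] = refl
spread-∅ (nothing ∷ o) = cong (false ∷_) (spread-∅ o)
spread-∅ (just i ∷ o) = cong₂ _∷_ (VP.lookup-replicate i false) (spread-∅ o)

spread-prepend-zero : ∀ {n k} B (o : Vec (Maybe (Fin k)) n) → spread (prependBlock B o) (unit zero) ≡ B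
spread-prepend-zero [] [] = refl
spread-prepend-zero (true ∷ B) (x ∷ o) = cong (true ∷_) (spread-prepend-zero B o)
spread-prepend-zero (false ∷ B) (nothing ∷ o) = cong (false ∷_) (spread-prepend-zero B o)
spread-prepend-zero (false ∷ B) (just i ∷ o) = cong₂ _∷_ (VP.lookup-replicate i false) (spread-prepend-zero B o)

spread-prepend-false : ∀ {n k} B (o : Vec (Maybe (Fin k)) n) y → (∀ v → lookup B v ≡ true → lookup o v ≡ nothing) →
                       spread (prependBlock B o) (false ∷ y) ≡ spread o y
spread-prepend-false [] [] y h = refl
spread-prepend-false (true ∷ B) (x ∷ o) y h with h zero refl
... | refl = cong (false ∷_) (spread-prepend-false B o y (λ v → h (suc v)))
spread-prepend-false (false ∷ B) (nothing ∷ o) y h = cong (false ∷_) (spread-prepend-false B o y (λ v → h (suc v)))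
spread-prepend-false (false ∷ B) (just i ∷ o) y h = cong (lookup y i ∷_) (spread-prepend-false B o y (λ v → h (suc v)))

size-∨ : ∀ {n} (H M : Vec Bool n) → size (zipWith _∨_ H M) ≤ size H + size M
size-∨ [] [] = ℕ.z≤n
size-∨ (true ∷ H) (true ∷ M) = ℕ.s≤s (ℕP.≤-trans (size-∨ H M) (ℕP.+-monoʳ-≤ (size H) (ℕP.n≤1+n _)))
size-∨ (true ∷ H) (false ∷ M) = ℕ.s≤s (size-∨ H M)
size-∨ (false ∷ H) (true ∷ M) = ℕP.≤-trans (ℕ.s≤s (size-∨ H M)) (ℕP.≤-reflexive (sym (ℕP.+-suc (size H) (size M))))
size-∨ (false ∷ H) (false ∷ M) = size-∨ H M

Meets : ∀ {n} → Vec Bool n → Vec Bool n → Set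
Meets S H = ∃ λ v → lookup S v ≡ true × lookup H v ≡ true

meets? : ∀ {n} (S H : Vec Bool n) → Dec (Meets S H)
meets? S H = FP.any? (λ v → (lookup S v BP.≟ true) ×-dec (lookup H v BP.≟ true))

search : ∀ {n} {P : Vec Bool n → Set} → Decidable P → ∃ P ⊎ (∀ S → ¬ P S)
search {zero} P? with P? []
... | yes p = inj₁ ([] , p)
... | no ¬p = inj₂ λ { [] → ¬p }
search {suc n} P? with search (λ S → P? (false ∷ S)) | search (λ S → P? (true ∷ S))
... | inj₁ (S , p) | _ = inj₁ (false ∷ S , p)
... | inj₂ _ | inj₁ (S , p) = inj₁ (true ∷ S , p)
... | inj₂ h₀ | inj₂ h₁ = inj₂ λ { (false ∷ S) → h₀ S ; (true ∷ S) → h₁ S }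

-- k disjoint monomials of degree d with union H, each containing a block (recorded in owner)
-- whose flip changes the value at 0.
record Family {n} (a : Coeffs n) (d k : ℕ) : Set where
  field
    H      : Vec Bool n
    size-H : size H ≤ k * d
    H-max  : ∀ v → lookup H v ≡ true → Σ (Vec Bool n) λ S → lookup S v ≡ true × a S ≢ 0ℤ × size S ≡ d
    owner  : Vec (Maybe (Fin k)) n
    owner-H : ∀ v → lookup H v ≡ false → lookup owner v ≡ nothing
    sensitive : ∀ i → ev a (spread owner (unit i)) ≢ ev a (spread owner ∅)

empty-family : ∀ {n} {a : Coeffs n} {d} → Family a d 0
empty-family {n} = record
  { H = ∅ ; size-H = ℕP.≤-reflexive (size-∅ n)
  ; H-max = λ v e → contradiction (trans (sym (VP.lookup-replicate v false)) e) (λ ())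
  ; owner = replicate n nothing ; owner-H = λ v _ → VP.lookup-replicate v nothing ; sensitive = λ () }

-- M avoids H, so the sensitive block inside M consists of unowned variables, and flipping an older
-- block gives the same point as before.
extend-family : ∀ {n} {a : Coeffs n} {d k} (F : Family a d k) M → 0 < d → size M ≡ d → a M ≢ 0ℤ → ¬ Meets M (Family.H F) →
                Family a d (suc k)
extend-family {n} {a} {d} {k} F M d>0 sz ne disj = record
  { H = zipWith _∨_ H M
  ; size-H = ℕP.≤-trans (size-∨ H M) (ℕP.≤-trans (ℕP.+-mono-≤ size-H (ℕP.≤-reflexive sz)) (ℕP.≤-reflexive (ℕP.+-comm (k * d) d)))
  ; H-max = max
  ; owner = owner′
  ; owner-H = owner-H′
  ; sensitive = sens }
  where
  open Family F
  block = sensitive-block a M (subst (0 <_) (sym sz) d>0) ne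
  B = proj₁ block
  owner′ = prependBlock B owner
  max : ∀ v → lookup (zipWith _∨_ H M) v ≡ true → Σ (Vec Bool n) λ S → lookup S v ≡ true × a S ≢ 0ℤ × size S ≡ d
  max v e with lookup H v in eH | lookup M v in eM | trans (sym (VP.lookup-zipWith _∨_ v H M)) e
  ... | true | _ | _ = H-max v eH
  ... | false | true | _ = M , eM , ne , sz
  ... | false | false | ()
  B⇒unowned : ∀ v → lookup B v ≡ true → lookup owner v ≡ nothing
  B⇒unowned v e = owner-H v (BP.¬-not (λ h → disj (v , proj₁ (proj₂ block) v e , h)))
  owner-H′ : ∀ v → lookup (zipWith _∨_ H M) v ≡ false → lookup owner′ v ≡ nothing
  owner-H′ v e with lookup H v in eH | lookup M v in eM | lookup B v in eB | trans (sym (VP.lookup-zipWith _∨_ v H M)) e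
  ... | false | false | true | _ = contradiction (trans (sym (proj₁ (proj₂ block) v eB)) eM) (λ ())
  ... | false | false | false | _ = trans (VP.lookup-zipWith _ v B owner)
    (trans (cong (λ b → if b then just zero else Maybe.map suc (lookup owner v)) eB) (cong (Maybe.map suc) (owner-H v eH)))
  at-∅ : spread owner′ ∅ ≡ spread owner ∅
  at-∅ = trans (spread-∅ owner′) (sym (spread-∅ owner))
  sens : ∀ i → ev a (spread owner′ (unit i)) ≢ ev a (spread owner′ ∅)
  sens zero e = proj₂ (proj₂ block) (trans (cong (ev a) (sym (spread-prepend-zero B owner))) (trans e (cong (ev a) (spread-∅ owner′))))
  sens (suc i) e = sensitive i (trans (cong (ev a) (sym (spread-prepend-false B owner (unit i) B⇒unowned))) (trans e (cong (ev a) at-∅)))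

Hitting : ∀ {n} → Coeffs n → ℕ → Vec Bool n → Set
Hitting a d H = ∀ S → size S ≡ d → a S ≢ 0ℤ → Meets S H

-- Greedy extension. It stops because running out of fuel would mean d² + 1 disjoint sensitive
-- blocks, against `block-bound`.
maximal-family : ∀ {n e} {a : Coeffs n} → ZeroOne a → DegreeAtMost a (suc e) →
                 ∃ λ k → Σ (Family a (suc e) k) λ F → Hitting a (suc e) (Family.H F)
maximal-family {n} {e} {a} 01-valued deg = grow (suc (d * d)) 0 (ℕP.+-identityʳ _) empty-family
  where
  d = suc e
  grow : ∀ fuel k → fuel + k ≡ suc (d * d) → Family a d k → ∃ λ k → Σ (Family a d k) λ F → Hitting a d (Family.H F)
  grow zero k eq F = contradiction (block-bound {a = a} 01-valued deg (Family.owner F) (Family.sensitive F))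
    (ℕP.<⇒≱ (ℕP.≤-reflexive (sym eq)))
  grow (suc fuel) k eq F with search (λ S → (size S ℕP.≟ d) ×-dec (¬? (a S ℤP.≟ 0ℤ) ×-dec ¬? (meets? S (Family.H F))))
  ... | inj₁ (M , sz , ne , disj) = grow fuel (suc k) (trans (ℕP.+-suc fuel k) eq) (extend-family {a = a} F M (ℕ.s≤s ℕ.z≤n) sz ne disj)
  ... | inj₂ none = k , F , hit
    where
    hit : Hitting a d (Family.H F)
    hit S sz ne with meets? S (Family.H F)
    ... | yes m = m
    ... | no ¬m = contradiction (sz , ne , ¬m) (none S)

-- The growth of the weight from one degree to the next.

∑ᶠ-mono : ∀ {n} {f g : Fin n → ℕ} → (∀ i → f i ≤ g i) → ∑ᶠ f ≤ ∑ᶠ g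
∑ᶠ-mono {zero} h = ℕ.z≤n
∑ᶠ-mono {suc n} h = ℕP.+-mono-≤ (h zero) (∑ᶠ-mono (λ i → h (suc i)))

∑ᶠ-+ : ∀ {n} (f g : Fin n → ℕ) → ∑ᶠ (λ i → f i + g i) ≡ ∑ᶠ f + ∑ᶠ g
∑ᶠ-+ {zero} f g = refl
∑ᶠ-+ {suc n} f g = trans (cong (f zero + g zero +_) (∑ᶠ-+ (λ i → f (suc i)) (λ i → g (suc i)))) (lem (f zero) (g zero) _ _)
  where
  lem : ∀ a b c d → a + b + (c + d) ≡ a + c + (b + d)
  lem = solve-∀

inside outside : ∀ {n} → Vec Bool n → (Fin n → ℕ) → Fin n → ℕ
inside H f i = if lookup H i then f i else 0
outside H f i = if lookup H i then 0 else f i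

inside+outside : ∀ {n} (H : Vec Bool n) f i → f i ≤ inside H f i + outside H f i
inside+outside H f i with lookup H i
... | true = ℕP.m≤m+n (f i) 0
... | false = ℕP.≤-refl

outside≤ : ∀ {n} (H : Vec Bool n) f i → outside H f i ≤ f i
outside≤ H f i with lookup H i
... | true = ℕ.z≤n
... | false = ℕP.≤-refl

∑-inside : ∀ {n C} K (H : Vec Bool n) f → (∀ i → lookup H i ≡ true → K * f i ≤ C) → K * ∑ᶠ (inside H f) ≤ size H * C
∑-inside K [] f h = ℕP.≤-reflexive (ℕP.*-zeroʳ K)
∑-inside K (true ∷ H) f h = ℕP.≤-trans (ℕP.≤-reflexive (ℕP.*-distribˡ-+ K (f zero) _))
  (ℕP.+-mono-≤ (h zero refl) (∑-inside K H (λ i → f (suc i)) (λ i → h (suc i))))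
∑-inside K (false ∷ H) f h = ∑-inside K H (λ i → f (suc i)) (λ i → h (suc i))

outsideWeight : ∀ {n} → Vec Bool n → Coeffs n → ℕ
outsideWeight H a = ∑ᶠ (outside H (λ i → Φ (∂ i a)))

-- A variable i outside H differs from j, so fixing xⱼ commutes with `∂ i`, and `Φ-restrict` applies
-- to each `∂ i a`.
outsideWeight-restrict : ∀ {n} (H : Vec Bool n) {j} a → lookup H j ≡ true →
  outsideWeight H a + outsideWeight H a ≤ outsideWeight H (restrict j false a) + outsideWeight H (restrict j true a)
outsideWeight-restrict H {j} a j∈H = ℕP.≤-trans (ℕP.≤-reflexive (sym (∑ᶠ-+ (w a) (w a))))
  (ℕP.≤-trans (∑ᶠ-mono step) (ℕP.≤-reflexive (∑ᶠ-+ (w (restrict j false a)) (w (restrict j true a)))))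
  where
  w = λ a → outside H (λ i → Φ (∂ i a))
  step : ∀ i → w a i + w a i ≤ w (restrict j false a) i + w (restrict j true a) i
  step i with lookup H i in eq
  ... | true = ℕ.z≤n
  ... | false = ℕP.≤-trans (Φ-restrict j (∂ i a)) (ℕP.+-mono-≤ (Φ-≗ (∂-restrict false a i≢j)) (Φ-≗ (∂-restrict true a i≢j)))
    where
    i≢j : i ≢ j
    i≢j refl = contradiction (trans (sym eq) j∈H) (λ ())

-- Restricting all variables of a hitting set in all possible ways lowers the degree, and the
-- weight of the remaining variables is at most the average over these restrictions.
restriction-tree : ∀ {n e B} (H : Vec Bool n) → (∀ b → ZeroOne b → DegreeAtMost b e → 2 ^ e * weight b ≤ B) →
  ∀ js → All (λ j → lookup H j ≡ true) js → ∀ a → ZeroOne a → DegreeAtMost a (suc e) →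
  (∀ S → size S ≡ suc e → a S ≢ 0ℤ → Any (λ j → lookup S j ≡ true) js) → 2 ^ e * outsideWeight H a ≤ B
restriction-tree {e = e} H bound [] [] a 01-valued deg hit =
  ℕP.≤-trans (ℕP.*-monoʳ-≤ (2 ^ e) (∑ᶠ-mono (outside≤ H _))) (bound a 01-valued deg′)
  where
  deg′ : DegreeAtMost a e
  deg′ S lt with a S ℤP.≟ 0ℤ
  ... | yes z = z
  -- No variable is left to hit a monomial of degree e + 1, so none exists.
  ... | no ne with () ← hit S (ℕP.≤-antisym (degree-≥ {b = a} ne deg) lt) ne
restriction-tree {e = e} {B} H bound (j ∷ js) (j∈H ∷ js∈H) a 01-valued deg hit = halve (2 ^ e) (outsideWeight-restrict H a j∈H) (branch false) (branch true)
  where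
  halve : ∀ K {x y z} → x + x ≤ y + z → K * y ≤ B → K * z ≤ B → K * x ≤ B
  halve K {x} {y} {z} h hy hz = ℕP.*-cancelˡ-≤ 2 (begin
    2 * (K * x)     ≡⟨ lem K x ⟩
    K * (x + x)     ≤⟨ ℕP.*-monoʳ-≤ K h ⟩
    K * (y + z)     ≡⟨ ℕP.*-distribˡ-+ K y z ⟩
    K * y + K * z   ≤⟨ ℕP.+-mono-≤ hy hz ⟩
    B + B           ≡⟨ cong (B +_) (sym (ℕP.+-identityʳ B)) ⟩
    2 * B ∎)
    where
    open ℕP.≤-Reasoning
    lem : ∀ K x → 2 * (K * x) ≡ K * (x + x)
    lem = solve-∀
  branch : ∀ c → 2 ^ e * outsideWeight H (restrict j c a) ≤ B
  branch c = restriction-tree H bound js js∈H (restrict j c a) (ZeroOne-restrict j c 01-valued) (deg-restrict j c {a} deg) hit′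
    where
    -- If S has size e + 1 and avoids j, adding j gives degree e + 2 and coefficient 0, so S keeps
    -- its coefficient from a. It is then hit by one of the remaining variables.
    hit′ : ∀ S → size S ≡ suc e → restrict j c a S ≢ 0ℤ → Any (λ j → lookup S j ≡ true) js
    hit′ S sz ne with lookup S j in eq
    ... | true = contradiction refl ne
    ... | false with hit S sz (λ z → ne (c*0 c z (deg (S [ j ]≔ true)
                   (ℕP.≤-reflexive (sym (trans (size-insert-∉ S j eq) (cong suc sz)))))))
    ...   | here e = contradiction (trans (sym eq) e) (λ ())
    ...   | there p = p

∂-witness : ∀ {n} {a : Coeffs n} {i S} → lookup S i ≡ true → ∂ i a (S [ i ]≔ false) ≡ a S × suc (size (S [ i ]≔ false)) ≡ size S
∂-witness {a = a} {i} {S} e = trans (∂-∉ {a = a} out) (cong a eq) , trans (sym (size-insert-∉ (S [ i ]≔ false) i out)) (cong size eq)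
  where
  out = VP.lookup∘update i S false
  eq : S [ i ]≔ false [ i ]≔ true ≡ S
  eq = trans (VP.[]≔-idempotent S i) (trans (cong (S [ i ]≔_) (sym e)) (VP.[]≔-lookup S i))

-- On the scale W = `weight` / 2ⁿ⁺¹, c is 2^(e + 1) times the bound in degree e, and the bound grows
-- by d³ 2^(-d) with d = e + 1. At most d k ≤ d³ variables lie in H; each belongs to a monomial of
-- degree d, so that 2^e Φ ≤ 2ⁿ. The other variables are covered by `restriction-tree`.
weight-step : ∀ {n e c} → (∀ (b : Coeffs n) → ZeroOne b → DegreeAtMost b e → 2 ^ e * weight b ≤ 2 ^ n * c) →
              ∀ a → ZeroOne a → DegreeAtMost a (suc e) →
              2 ^ suc e * weight a ≤ 2 ^ n * (2 * (c + suc e * suc e * suc e))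
weight-step {n} {e} {c} bound a 01-valued deg with maximal-family {a = a} 01-valued deg
... | k , F , hit = begin
    2 * 2 ^ e * weight a
      ≡⟨ ℕP.*-assoc 2 (2 ^ e) (weight a) ⟩
    2 * (2 ^ e * weight a)
      ≤⟨ ℕP.*-monoʳ-≤ 2 (ℕP.*-monoʳ-≤ (2 ^ e) (∑ᶠ-mono (inside+outside H w))) ⟩
    2 * (2 ^ e * ∑ᶠ (λ i → inside H w i + outside H w i))
      ≡⟨ cong (λ z → 2 * (2 ^ e * z)) (∑ᶠ-+ (inside H w) (outside H w)) ⟩
    2 * (2 ^ e * (∑ᶠ (inside H w) + outsideWeight H a))
      ≡⟨ cong (2 *_) (ℕP.*-distribˡ-+ (2 ^ e) (∑ᶠ (inside H w)) (outsideWeight H a)) ⟩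
    2 * (2 ^ e * ∑ᶠ (inside H w) + 2 ^ e * outsideWeight H a)
      ≤⟨ ℕP.*-monoʳ-≤ 2 (ℕP.+-mono-≤
           (ℕP.≤-trans (∑-inside (2 ^ e) H w in-H) (ℕP.*-monoˡ-≤ (2 ^ n) (ℕP.≤-trans size-H (ℕP.*-monoˡ-≤ d k≤d²))))
           (restriction-tree H bound js (AllP.all-filter (λ j → lookup H j BP.≟ true) (allFin n)) a 01-valued deg hit-js)) ⟩
    2 * (d * d * d * 2 ^ n + 2 ^ n * c)
      ≡⟨ lem (d * d * d) (2 ^ n) c ⟩
    2 ^ n * (2 * (c + d * d * d)) ∎
  where
  open ℕP.≤-Reasoning
  open Family F
  d = suc e
  w : Fin n → ℕ
  w i = Φ (∂ i a)
  k≤d² : k ≤ d * d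
  k≤d² = block-bound {a = a} 01-valued deg owner sensitive
  js = filter (λ j → lookup H j BP.≟ true) (allFin n)
  hit-js : ∀ S → size S ≡ suc e → a S ≢ 0ℤ → Any (λ j → lookup S j ≡ true) js
  hit-js S sz ne with hit S sz ne
  ... | v , v∈S , v∈H = lose (∈-filter⁺ (λ j → lookup H j BP.≟ true) (∈-allFin v) v∈H) v∈S
  in-H : ∀ i → lookup H i ≡ true → 2 ^ e * w i ≤ 2 ^ n
  in-H i i∈H with H-max i i∈H
  ... | S , i∈S , ne , sz with ∂-witness {a = a} i∈S
  ...   | val , sz′ = subst (λ s → 2 ^ s * w i ≤ 2 ^ n) (ℕP.suc-injective (trans sz′ sz))
                        (Φ-upper {b = ∂ i a} (λ z → ne (trans (sym val) z)))
  lem : ∀ x p c → 2 * (x * p + p * c) ≡ p * (2 * (c + x))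
  lem = solve-∀

-- Solving the recursion and counting relevant variables.

ceiling : ℕ → ℕ → ℕ
ceiling e zero = e * 2 ^ e
ceiling e (suc t) = 2 * (ceiling e t + suc (t + e) * suc (t + e) * suc (t + e))

-- `ceiling e t` is 2^(t + e + 1) times the bound on W in degree t + e, which starts from W ≤ e / 2
-- and takes t steps.
weight-bound : ∀ e t {n} (a : Coeffs n) → ZeroOne a → DegreeAtMost a (t + e) → 2 ^ (t + e) * weight a ≤ 2 ^ n * ceiling e t
weight-bound e zero {n} a 01-valued deg = ℕP.≤-trans (ℕP.*-monoʳ-≤ (2 ^ e) (weight≤degree {a = a} 01-valued deg))
  (ℕP.≤-reflexive (lem (2 ^ e) e (2 ^ n)))
  where
  lem : ∀ x e y → x * (e * y) ≡ y * (e * x)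
  lem = solve-∀
weight-bound e (suc t) = weight-step (weight-bound e t)

tailSum : ℕ → ℕ
tailSum d = d * d * d + 6 * (d * d) + 18 * d + 26

-- 2⁻ᵈ tailSum d is the sum of i³ 2⁻ⁱ over i > d.
ceiling-closed : ∀ e t → ceiling e t + 2 * tailSum (t + e) ≡ (e * 2 ^ e + 2 * tailSum e) * 2 ^ t
ceiling-closed e zero = sym (ℕP.*-identityʳ _)
ceiling-closed e (suc t) = trans (lem₁ (ceiling e t) (t + e))
  (trans (cong (2 *_) (ceiling-closed e t)) (lem₂ (e * 2 ^ e + 2 * tailSum e) (2 ^ t)))
  where
  lem₁ : ∀ c d → 2 * (c + suc d * suc d * suc d)
           + 2 * (suc d * suc d * suc d + 6 * (suc d * suc d) + 18 * suc d + 26)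
       ≡ 2 * (c + 2 * (d * d * d + 6 * (d * d) + 18 * d + 26))
  lem₁ = solve-∀
  lem₂ : ∀ x p → 2 * (x * p) ≡ x * (2 * p)
  lem₂ = solve-∀

length-filter : ∀ {A : Set} {n C} {P : A → Set} (P? : Decidable P) (g : Fin n → A) K (f : Fin n → ℕ) →
                (∀ i → P (g i) → C ≤ K * f i) → C * length (filter P? (tabulate g)) ≤ K * ∑ᶠ f
length-filter {n = zero} {C} P? g K f h = ℕP.≤-trans (ℕP.≤-reflexive (ℕP.*-zeroʳ C)) ℕ.z≤n
length-filter {n = suc n} {C} P? g K f h with P? (g zero)
... | yes p = ℕP.≤-trans (ℕP.≤-reflexive (ℕP.*-suc C _))
  (ℕP.≤-trans (ℕP.+-mono-≤ (h zero p) (length-filter P? (λ i → g (suc i)) K (λ i → f (suc i)) (λ i → h (suc i))))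
              (ℕP.≤-reflexive (sym (ℕP.*-distribˡ-+ K (f zero) (∑ᶠ (λ i → f (suc i)))))))
... | no _ = ℕP.≤-trans (length-filter P? (λ i → g (suc i)) K (λ i → f (suc i)) (λ i → h (suc i))) (ℕP.*-monoʳ-≤ K (ℕP.m≤n+m (∑ᶠ (λ i → f (suc i))) (f zero)))

deg-∂ : ∀ {n e} i {a : Coeffs n} → DegreeAtMost a (suc e) → DegreeAtMost (∂ i a) e
deg-∂ i deg S lt with lookup S i in eq
... | true = refl
... | false = deg _ (ℕP.≤-trans (ℕ.s≤s lt) (ℕP.≤-reflexive (sym (size-insert-∉ S i eq))))

-- This is R ≤ 2^d W for d = e + 1: if xᵢ is relevant, `∂ i a` is nonzero of degree at most e, so
-- its Φ is at least 2^(n - e).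
relevant-count : ∀ {n e} {a : Coeffs n} → DegreeAtMost a (suc e) → 2 ^ n * numRelevant a ≤ 2 ^ e * weight a
relevant-count {n} {e} {a} deg = length-filter (relevant? a) (λ i → i) (2 ^ e) (λ i → Φ (∂ i a)) heavy
  where
  heavy : ∀ i → Relevant a i → 2 ^ n ≤ 2 ^ e * Φ (∂ i a)
  heavy i r with satisfied r
  ... | S , i∈S , ne = Φ-lower {b = ∂ i a} {S [ i ]≔ false} (λ z → ne (trans (sym (proj₁ (∂-witness {a = a} i∈S))) z)) (deg-∂ i {a} deg)

relevant-bound : ∀ e t {n} {a : Coeffs n} → ZeroOne a → DegreeAtMost a (t + suc e) → 2 * numRelevant a ≤ ceiling (suc e) t
relevant-bound e t {n} {a} 01-valued deg = ℕP.*-cancelˡ-≤ (2 ^ n) {{ℕP.m^n≢0 2 n}} (begin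
  2 ^ n * (2 * numRelevant a)      ≡⟨ lem (2 ^ n) (numRelevant a) ⟩
  2 * (2 ^ n * numRelevant a)      ≤⟨ ℕP.*-monoʳ-≤ 2 (relevant-count {a = a} (subst (DegreeAtMost a) (ℕP.+-suc t e) deg)) ⟩
  2 * (2 ^ (t + e) * weight a)     ≡⟨ sym (ℕP.*-assoc 2 (2 ^ (t + e)) (weight a)) ⟩
  2 ^ suc (t + e) * weight a       ≡⟨ cong (λ s → 2 ^ s * weight a) (sym (ℕP.+-suc t e)) ⟩
  2 ^ (t + suc e) * weight a       ≤⟨ weight-bound (suc e) t a 01-valued deg ⟩
  2 ^ n * ceiling (suc e) t ∎)
  where
  open ℕP.≤-Reasoning
  lem : ∀ p r → p * (2 * r) ≡ 2 * (p * r)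
  lem = solve-∀

-- The doubling construction for the lower bound.

left : ∀ l {m} → Vec Bool (l + m) → Vec Bool l
left zero z = []
left (suc l) (b ∷ z) = b ∷ left l z

right : ∀ l {m} → Vec Bool (l + m) → Vec Bool m
right zero z = z
right (suc l) (b ∷ z) = right l z

-- The factor `one S` at the end keeps only the monomials that avoid the last m variables.
onLeft : ∀ {l} m → Coeffs l → Coeffs (l + m)
onLeft {zero} m a S = a [] ℤ.* one S
onLeft {suc l} m a (b ∷ S) = onLeft m (λ T → a (b ∷ T)) S

onRight : ∀ l {m} → Coeffs m → Coeffs (l + m)
onRight zero a = a
onRight (suc l) a (false ∷ S) = onRight l a S
onRight (suc l) a (true ∷ S) = 0ℤ

ev-onLeft : ∀ {l m} (a : Coeffs l) z → ev (onLeft m a) z ≡ ev a (left l z)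
ev-onLeft {zero} a z = trans (ev-cong (λ S → lem₁ (a []) (one S)) z) (trans (ev-linear (a []) 0ℤ one one z)
  (trans (cong (λ o → a [] ℤ.* o ℤ.+ 0ℤ ℤ.* o) (ev-one z)) (lem₂ (a []))))
  where
  lem₁ : ∀ c o → c ℤ.* o ≡ c ℤ.* o ℤ.+ 0ℤ ℤ.* o
  lem₁ = solveℤ-∀
  lem₂ : ∀ c → c ℤ.* 1ℤ ℤ.+ 0ℤ ℤ.* 1ℤ ≡ c
  lem₂ = solveℤ-∀
ev-onLeft {suc l} a (b ∷ z) = cong₂ (λ u v → u ℤ.+ toℤ b ℤ.* v) (ev-onLeft (lo a) z) (ev-onLeft (hi a) z)

ev-onRight : ∀ l {m} (a : Coeffs m) z → ev (onRight l a) z ≡ ev a (right l z)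
ev-onRight zero a z = refl
ev-onRight (suc l) a (b ∷ z) = trans (cong₂ (λ u v → u ℤ.+ toℤ b ℤ.* v) (ev-onRight l a z) (ev-0 (λ _ → refl) z))
  (trans (cong (λ w → ev a (right l z) ℤ.+ w) (ℤP.*-zeroʳ (toℤ b))) (ℤP.+-identityʳ _))

deg-onLeft : ∀ {l m d} (a : Coeffs l) → DegreeAtMost a d → DegreeAtMost (onLeft m a) d
deg-onLeft {zero} a deg S h = trans (cong (a [] ℤ.*_) (deg-one S h)) (ℤP.*-zeroʳ (a []))
deg-onLeft {suc l} a deg (false ∷ S) h = deg-onLeft (lo a) (deg-lo {a = a} deg) S h
deg-onLeft {suc l} {d = suc d} a deg (true ∷ S) h = deg-onLeft (hi a) (deg-hi {a = a} deg) S (ℕP.≤-pred h)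
deg-onLeft {suc l} {m} {zero} a deg (true ∷ S) h = zero-coeffs (hi a) (deg-hi-0 {a = a} deg) S
  where
  zero-coeffs : ∀ {l} (a : Coeffs l) → (∀ S → a S ≡ 0ℤ) → ∀ S → onLeft m a S ≡ 0ℤ
  zero-coeffs {zero} a z S = trans (cong (ℤ._* one S) (z [])) (ℤP.*-zeroˡ (one S))
  zero-coeffs {suc l} a z (b ∷ S) = zero-coeffs (λ T → a (b ∷ T)) (λ T → z (b ∷ T)) S

deg-onRight : ∀ l {m d} (a : Coeffs m) → DegreeAtMost a d → DegreeAtMost (onRight l a) d
deg-onRight zero a deg = deg
deg-onRight (suc l) a deg (false ∷ S) h = deg-onRight l a deg S h
deg-onRight (suc l) a deg (true ∷ S) h = refl

onLeft-++ : ∀ {l m} (a : Coeffs l) S (T : Vec Bool m) → onLeft m a (S ++ T) ≡ a S ℤ.* one T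
onLeft-++ a [] T = refl
onLeft-++ a (b ∷ S) T = onLeft-++ (λ T → a (b ∷ T)) S T

onRight-∅++ : ∀ l {m} (a : Coeffs m) T → onRight l a (∅ {l} ++ T) ≡ a T
onRight-∅++ zero a T = refl
onRight-∅++ (suc l) a T = onRight-∅++ l a T

one-∅ : ∀ n → one (∅ {n}) ≡ 1ℤ
one-∅ zero = refl
one-∅ (suc n) = one-∅ n

one-nonempty : ∀ {n} {S : Vec Bool n} i → lookup S i ≡ true → one S ≡ 0ℤ
one-nonempty {S = true ∷ S} i e = refl
one-nonempty {S = false ∷ S} (suc i) e = one-nonempty i e

AllRelevant : ∀ {n} → Coeffs n → Set
AllRelevant {n} a = ∀ i → Σ (Vec Bool n) λ S → lookup S i ≡ true × a S ≢ 0ℤ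

-- The selectors s, t and two copies X, Y of the variables of f: the value is
-- 1 − f(X), 1 − f(Y), f(Y), f(X) for (s, t) = (0,0), (0,1), (1,0), (1,1).
-- The alternating sum of these four vanishes, so st does not occur and the degree grows by one only.
double : ∀ {l} → Coeffs l → Coeffs (suc (suc (l + l)))
double {l} a (false ∷ false ∷ S) = 1ℤ ℤ.* one S ℤ.+ ℤ.- 1ℤ ℤ.* onLeft l a S
double {l} a (false ∷ true ∷ S) = 1ℤ ℤ.* onLeft l a S ℤ.+ ℤ.- 1ℤ ℤ.* onRight l a S
double {l} a (true ∷ false ∷ S) = 1ℤ ℤ.* (1ℤ ℤ.* onRight l a S ℤ.+ 1ℤ ℤ.* onLeft l a S) ℤ.+ ℤ.- 1ℤ ℤ.* one S
double a (true ∷ true ∷ S) = 0ℤ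

ev-double : ∀ {l} (a : Coeffs l) s t z → let u = ev a (left l z); v = ev a (right l z) in
  ev (double a) (s ∷ t ∷ z) ≡
  (1ℤ ℤ.* 1ℤ ℤ.+ ℤ.- 1ℤ ℤ.* u ℤ.+ toℤ t ℤ.* (1ℤ ℤ.* u ℤ.+ ℤ.- 1ℤ ℤ.* v)) ℤ.+
  toℤ s ℤ.* (1ℤ ℤ.* (1ℤ ℤ.* v ℤ.+ 1ℤ ℤ.* u) ℤ.+ ℤ.- 1ℤ ℤ.* 1ℤ ℤ.+ toℤ t ℤ.* 0ℤ)
ev-double {l} a s t z
  rewrite ev-linear 1ℤ (ℤ.- 1ℤ) one (onLeft l a) z
        | ev-linear 1ℤ (ℤ.- 1ℤ) (onLeft l a) (onRight l a) z
        | ev-linear 1ℤ (ℤ.- 1ℤ) (λ S → 1ℤ ℤ.* onRight l a S ℤ.+ 1ℤ ℤ.* onLeft l a S) one z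
        | ev-linear 1ℤ 1ℤ (onRight l a) (onLeft l a) z
        | ev-one z | ev-onLeft {m = l} a z | ev-onRight l a z
        | ev-0 {a = λ (_ : Vec Bool (l + l)) → 0ℤ} (λ _ → refl) z = refl

ZeroOne-double : ∀ {l} {a : Coeffs l} → ZeroOne a → ZeroOne (double a)
ZeroOne-double {l} {a} h (s ∷ t ∷ z) = subst (λ i → i ≡ 0ℤ ⊎ i ≡ 1ℤ) (sym (ev-double a s t z)) (select s t)
  where
  u = ev a (left l z)
  v = ev a (right l z)
  complement : ∀ {i} → i ≡ 0ℤ ⊎ i ≡ 1ℤ → 1ℤ ℤ.- i ≡ 0ℤ ⊎ 1ℤ ℤ.- i ≡ 1ℤ
  complement (inj₁ refl) = inj₂ refl
  complement (inj₂ refl) = inj₁ refl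
  formula : ℤ → ℤ → ℤ → ℤ → ℤ
  formula s t u v = (1ℤ ℤ.* 1ℤ ℤ.+ ℤ.- 1ℤ ℤ.* u ℤ.+ t ℤ.* (1ℤ ℤ.* u ℤ.+ ℤ.- 1ℤ ℤ.* v)) ℤ.+
    s ℤ.* (1ℤ ℤ.* (1ℤ ℤ.* v ℤ.+ 1ℤ ℤ.* u) ℤ.+ ℤ.- 1ℤ ℤ.* 1ℤ ℤ.+ t ℤ.* 0ℤ)
  eq₀₀ : ∀ u v → 1ℤ ℤ.- u ≡ (1ℤ ℤ.* 1ℤ ℤ.+ ℤ.- 1ℤ ℤ.* u ℤ.+ 0ℤ ℤ.* (1ℤ ℤ.* u ℤ.+ ℤ.- 1ℤ ℤ.* v)) ℤ.+
    0ℤ ℤ.* (1ℤ ℤ.* (1ℤ ℤ.* v ℤ.+ 1ℤ ℤ.* u) ℤ.+ ℤ.- 1ℤ ℤ.* 1ℤ ℤ.+ 0ℤ ℤ.* 0ℤ)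
  eq₀₀ = solveℤ-∀
  eq₀₁ : ∀ u v → 1ℤ ℤ.- v ≡ (1ℤ ℤ.* 1ℤ ℤ.+ ℤ.- 1ℤ ℤ.* u ℤ.+ 1ℤ ℤ.* (1ℤ ℤ.* u ℤ.+ ℤ.- 1ℤ ℤ.* v)) ℤ.+
    0ℤ ℤ.* (1ℤ ℤ.* (1ℤ ℤ.* v ℤ.+ 1ℤ ℤ.* u) ℤ.+ ℤ.- 1ℤ ℤ.* 1ℤ ℤ.+ 1ℤ ℤ.* 0ℤ)
  eq₀₁ = solveℤ-∀
  eq₁₀ : ∀ u v → v ≡ (1ℤ ℤ.* 1ℤ ℤ.+ ℤ.- 1ℤ ℤ.* u ℤ.+ 0ℤ ℤ.* (1ℤ ℤ.* u ℤ.+ ℤ.- 1ℤ ℤ.* v)) ℤ.+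
    1ℤ ℤ.* (1ℤ ℤ.* (1ℤ ℤ.* v ℤ.+ 1ℤ ℤ.* u) ℤ.+ ℤ.- 1ℤ ℤ.* 1ℤ ℤ.+ 0ℤ ℤ.* 0ℤ)
  eq₁₀ = solveℤ-∀
  eq₁₁ : ∀ u v → u ≡ (1ℤ ℤ.* 1ℤ ℤ.+ ℤ.- 1ℤ ℤ.* u ℤ.+ 1ℤ ℤ.* (1ℤ ℤ.* u ℤ.+ ℤ.- 1ℤ ℤ.* v)) ℤ.+
    1ℤ ℤ.* (1ℤ ℤ.* (1ℤ ℤ.* v ℤ.+ 1ℤ ℤ.* u) ℤ.+ ℤ.- 1ℤ ℤ.* 1ℤ ℤ.+ 1ℤ ℤ.* 0ℤ)
  eq₁₁ = solveℤ-∀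
  01? : ∀ {i} j → i ≡ j → i ≡ 0ℤ ⊎ i ≡ 1ℤ → j ≡ 0ℤ ⊎ j ≡ 1ℤ
  01? j refl p = p
  select : ∀ s t → formula (toℤ s) (toℤ t) u v ≡ 0ℤ ⊎ formula (toℤ s) (toℤ t) u v ≡ 1ℤ
  select false false = 01? _ (eq₀₀ u v) (complement (h (left l z)))
  select false true = 01? _ (eq₀₁ u v) (complement (h (right l z)))
  select true false = 01? _ (eq₁₀ u v) (h (right l z))
  select true true = 01? _ (eq₁₁ u v) (h (left l z))

deg-double : ∀ {l d} {a : Coeffs l} → DegreeAtMost a d → DegreeAtMost (double a) (suc d)
deg-double {a = a} deg (false ∷ false ∷ S) h = cong₂ (λ u v → 1ℤ ℤ.* u ℤ.+ ℤ.- 1ℤ ℤ.* v) (deg-one S h) (deg-onLeft a deg S (ℕP.<-trans (ℕP.n<1+n _) h))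
deg-double {l} {a = a} deg (false ∷ true ∷ S) h = cong₂ (λ u v → 1ℤ ℤ.* u ℤ.+ ℤ.- 1ℤ ℤ.* v) (deg-onLeft a deg S (ℕP.≤-pred h)) (deg-onRight l a deg S (ℕP.≤-pred h))
deg-double {l} {a = a} deg (true ∷ false ∷ S) h =
  trans (cong₂ (λ u v → 1ℤ ℤ.* (1ℤ ℤ.* u ℤ.+ 1ℤ ℤ.* v) ℤ.+ ℤ.- 1ℤ ℤ.* one S) (deg-onRight l a deg S (ℕP.≤-pred h)) (deg-onLeft a deg S (ℕP.≤-pred h)))
        (cong (λ o → 0ℤ ℤ.+ ℤ.- 1ℤ ℤ.* o) (deg-one S (ℕP.≤-pred h)))
deg-double deg (true ∷ true ∷ S) h = refl

-- A nonempty monomial of the copy Y receives nothing from the constant 1 or from f(X). Multiplied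
-- by s or t it therefore has a coefficient of f up to sign, which serves s, t and all of Y. The
-- variables of X occur already in 1 - f(X). `i₀` ensures that a nonempty monomial exists.
AllRelevant-double : ∀ {l} {a : Coeffs l} → Fin l → AllRelevant a → AllRelevant (double a)
AllRelevant-double {l} {a} i₀ rel = λ where
    zero → true ∷ false ∷ (∅ {l} ++ S₀) , refl , λ e → ne₀ (trans (sym (at-s S₀ i₀ i₀∈S₀)) e)
    (suc zero) → false ∷ true ∷ (∅ {l} ++ S₀) , refl , λ e → ne₀ (neg-0 (trans (sym at-t) e))
    (suc (suc i)) → copy i (splitAt l i) refl
  where
  S₀ = proj₁ (rel i₀)
  i₀∈S₀ = proj₁ (proj₂ (rel i₀))
  ne₀ = proj₂ (proj₂ (rel i₀))
  neg-0 : ∀ {i} → ℤ.- i ≡ 0ℤ → i ≡ 0ℤ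
  neg-0 e = trans (sym (ℤP.neg-involutive _)) (cong ℤ.-_ e)
  onLeft-0 : ∀ T i → lookup T i ≡ true → onLeft l a (∅ {l} ++ T) ≡ 0ℤ
  onLeft-0 T i e = trans (onLeft-++ a ∅ T) (trans (cong (a ∅ ℤ.*_) (one-nonempty i e)) (ℤP.*-zeroʳ (a ∅)))
  one-∅++ : ∀ l (T : Vec Bool l) i → lookup T i ≡ true → ∀ m → one (∅ {m} ++ T) ≡ 0ℤ
  one-∅++ l T i e zero = one-nonempty i e
  one-∅++ l T i e (suc m) = one-∅++ l T i e m
  at-s : ∀ T i → lookup T i ≡ true → double a (true ∷ false ∷ (∅ {l} ++ T)) ≡ a T
  at-s T i e rewrite onRight-∅++ l a T | onLeft-0 T i e | one-∅++ l T i e l = lem (a T)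
    where
    lem : ∀ x → 1ℤ ℤ.* (1ℤ ℤ.* x ℤ.+ 1ℤ ℤ.* 0ℤ) ℤ.+ ℤ.- 1ℤ ℤ.* 0ℤ ≡ x
    lem = solveℤ-∀
  at-t : double a (false ∷ true ∷ (∅ {l} ++ S₀)) ≡ ℤ.- a S₀
  at-t rewrite onRight-∅++ l a S₀ | onLeft-0 S₀ i₀ i₀∈S₀ = lem (a S₀)
    where
    lem : ∀ x → 1ℤ ℤ.* 0ℤ ℤ.+ ℤ.- 1ℤ ℤ.* x ≡ ℤ.- x
    lem = solveℤ-∀
  at-00 : ∀ S i → lookup (S ++ ∅ {l}) i ≡ true → double a (false ∷ false ∷ (S ++ ∅ {l})) ≡ ℤ.- a S
  at-00 S i e = trans (cong₂ (λ u v → 1ℤ ℤ.* u ℤ.+ ℤ.- 1ℤ ℤ.* v) (one-nonempty {S = S ++ ∅ {l}} i e)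
    (trans (onLeft-++ a S (∅ {l})) (cong (a S ℤ.*_) (one-∅ l)))) (lem (a S))
    where
    lem : ∀ x → 1ℤ ℤ.* 0ℤ ℤ.+ ℤ.- 1ℤ ℤ.* (x ℤ.* 1ℤ) ≡ ℤ.- x
    lem = solveℤ-∀
  copy : ∀ i (w : Fin l ⊎ Fin l) → splitAt l i ≡ w →
         Σ (Vec Bool (suc (suc (l + l)))) λ S → lookup S (suc (suc i)) ≡ true × double a S ≢ 0ℤ
  copy i (inj₁ j) eq = false ∷ false ∷ (S ++ ∅ {l}) , i∈ , λ e → proj₂ (proj₂ (rel j)) (neg-0 (trans (sym (at-00 S i i∈)) e))
    where
    S = proj₁ (rel j)
    i∈ : lookup (S ++ ∅ {l}) i ≡ true
    i∈ = trans (VP.lookup-splitAt l S ∅ i) (trans (cong [ lookup S , lookup ∅ ]′ eq) (proj₁ (proj₂ (rel j))))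
  copy i (inj₂ j) eq = true ∷ false ∷ (∅ {l} ++ T) , i∈ , λ e → proj₂ (proj₂ (rel j)) (trans (sym (at-s T j (proj₁ (proj₂ (rel j))))) e)
    where
    T = proj₁ (rel j)
    i∈ : lookup (∅ {l} ++ T) i ≡ true
    i∈ = trans (VP.lookup-splitAt l ∅ T i) (trans (cong [ lookup ∅ , lookup T ]′ eq) (proj₁ (proj₂ (rel j))))

record Example (d n : ℕ) : Set where
  field
    coeffs   : Coeffs n
    01-valued : ZeroOne coeffs
    degree   : DegreeAtMost coeffs d
    relevant : AllRelevant coeffs
    variable₀ : Fin n

dictator : Example 1 1
dictator = record
  { coeffs = λ S → toℤ (lookup S zero)
  ; 01-valued = λ { (false ∷ []) → inj₁ refl ; (true ∷ []) → inj₂ refl }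
  ; degree = λ { (false ∷ []) _ → refl ; (true ∷ []) (ℕ.s≤s ()) }
  ; relevant = λ { zero → true ∷ [] , refl , λ () }
  ; variable₀ = zero }

example-double : ∀ {d n} → Example d n → Example (suc d) (suc (suc (n + n)))
example-double E = record
  { coeffs = double (Example.coeffs E)
  ; 01-valued = ZeroOne-double {a = Example.coeffs E} (Example.01-valued E)
  ; degree = deg-double {a = Example.coeffs E} (Example.degree E)
  ; relevant = AllRelevant-double {a = Example.coeffs E} (Example.variable₀ E) (Example.relevant E)
  ; variable₀ = zero }

-- n + 2 starts at 3 and doubles with every step, since 2 n + 2 + 2 = 2 (n + 2).
many-variables : ∀ t → Σ ℕ λ n → Example (suc t) n × n + 2 ≡ 3 * 2 ^ t
many-variables zero = 1 , dictator , refl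
many-variables (suc t) with many-variables t
... | n , E , eq = suc (suc (n + n)) , example-double E , trans (lem n) (trans (cong (2 *_) eq) (lem′ (2 ^ t)))
  where
  lem : ∀ n → suc (suc (n + n)) + 2 ≡ 2 * (n + 2)
  lem = solve-∀
  lem′ : ∀ p → 2 * (3 * p) ≡ 3 * (2 * p)
  lem′ = solve-∀

-- Passage to Boolean functions and the final estimates.

∈-allVecs : ∀ {n} (S : Vec Bool n) → S ∈ allVecs n
∈-allVecs [] = here refl
∈-allVecs (false ∷ S) = ∈-++⁺ˡ (∈-map⁺ (false ∷_) (∈-allVecs S))
∈-allVecs {suc n} (true ∷ S) = ∈-++⁺ʳ (List.map (false ∷_) (allVecs n)) (∈-map⁺ (true ∷_) (∈-allVecs S))

numRelevant-all : ∀ {n} {a : Coeffs n} → AllRelevant a → numRelevant a ≡ n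
numRelevant-all {n} {a} rel = trans
  (cong length (LP.filter-all (relevant? a) (universal (λ i → let (S , p) = rel i in lose (∈-allVecs S) p) (allFin n))))
  (LP.length-tabulate (λ i → i))

function : ∀ {n} {a : Coeffs n} → ZeroOne a → Σ (BoolFun n) λ f → Represents f a
function {a = a} h = (λ x → value (h x)) , λ x → trans (evalPoly≡ev a x) (value-eq (h x))
  where
  value : ∀ {i} → i ≡ 0ℤ ⊎ i ≡ 1ℤ → Bool
  value (inj₁ _) = false
  value (inj₂ _) = true
  value-eq : ∀ {i} (v : i ≡ 0ℤ ⊎ i ≡ 1ℤ) → i ≡ toℤ (value v)
  value-eq (inj₁ e) = e
  value-eq (inj₂ e) = e

represents-ZeroOne : ∀ {n} {f : BoolFun n} {a : Coeffs n} → Represents f a → ZeroOne a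
represents-ZeroOne {f = f} {a} rep x with f x | rep x
... | false | e = inj₁ (trans (sym (evalPoly≡ev a x)) e)
... | true | e = inj₂ (trans (sym (evalPoly≡ev a x)) e)

-- n / (2 p) = 3/2 - 1/p, and p ≥ m + 1. Adding 4 (m + 1) to both sides avoids truncated
-- subtraction.
lower-arithmetic : ∀ m n p → suc m ≤ p → n + 2 ≡ 3 * p → (3 * suc m ∸ 2) * (2 * p) ≤ 2 * suc m * n
lower-arithmetic m n p m<p eq = ℕP.+-cancelʳ-≤ (2 * M * 2) _ _ (begin
  K * (2 * p) + 2 * M * 2           ≤⟨ ℕP.+-monoʳ-≤ (K * (2 * p)) (ℕP.≤-trans (ℕP.≤-reflexive (lem₁ M)) (ℕP.*-monoʳ-≤ 4 m<p)) ⟩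
  K * (2 * p) + 4 * p               ≡⟨ lem₂ K p ⟩
  2 * ((K + 2) * p)                 ≡⟨ cong (λ z → 2 * (z * p)) (ℕP.m∸n+n≡m {3 * M} {2} (ℕP.≤-trans (ℕP.n≤1+n 2) (ℕP.*-monoʳ-≤ 3 (ℕ.s≤s ℕ.z≤n)))) ⟩
  2 * (3 * M * p)                   ≡⟨ lem₃ M p ⟩
  2 * M * (3 * p)                   ≡⟨ cong (2 * M *_) (sym eq) ⟩
  2 * M * (n + 2)                   ≡⟨ ℕP.*-distribˡ-+ (2 * M) n 2 ⟩
  2 * M * n + 2 * M * 2 ∎)
  where
  open ℕP.≤-Reasoning
  M = suc m
  K = 3 * M ∸ 2
  lem₁ : ∀ M → 2 * M * 2 ≡ 4 * M
  lem₁ = solve-∀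
  lem₂ : ∀ K p → K * (2 * p) + 4 * p ≡ 2 * ((K + 2) * p)
  lem₂ = solve-∀
  lem₃ : ∀ M p → 2 * (3 * M * p) ≡ 2 * M * (3 * p)
  lem₃ = solve-∀

n≤2^n : ∀ n → n ≤ 2 ^ n
n≤2^n zero = ℕ.z≤n
n≤2^n (suc n) = ℕP.≤-trans (ℕP.+-mono-≤ (ℕP.m^n>0 2 n) (n≤2^n n)) (ℕP.≤-reflexive (cong (2 ^ n +_) (sym (ℕP.+-identityʳ (2 ^ n)))))

-- R ≤ K p / 2 ≤ (g / c) p q with denominators cleared; the surplus c p q is the slack 1 / M.
upper-arithmetic : ∀ c g K q R p M → c * K ≤ 2 * (g * q) → 2 * R ≤ K * p → c * M * R ≤ (g * M + c) * (p * q)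
upper-arithmetic c g K q R p M cK 2R = ℕP.*-cancelˡ-≤ 2 (begin
  2 * (c * M * R)               ≡⟨ lem₁ c M R ⟩
  c * M * (2 * R)               ≤⟨ ℕP.*-monoʳ-≤ (c * M) 2R ⟩
  c * M * (K * p)               ≡⟨ lem₂ c M K p ⟩
  c * K * (M * p)               ≤⟨ ℕP.*-monoˡ-≤ (M * p) cK ⟩
  2 * (g * q) * (M * p)         ≤⟨ ℕP.m≤m+n _ (2 * (c * (p * q))) ⟩
  2 * (g * q) * (M * p) + 2 * (c * (p * q)) ≡⟨ lem₃ g q M p c ⟩
  2 * ((g * M + c) * (p * q)) ∎)
  where
  open ℕP.≤-Reasoning
  lem₁ : ∀ c M R → 2 * (c * M * R) ≡ c * M * (2 * R)
  lem₁ = solve-∀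
  lem₂ : ∀ c M K p → c * M * (K * p) ≡ c * K * (M * p)
  lem₂ = solve-∀
  lem₃ : ∀ g q M p c → 2 * (g * q) * (M * p) + 2 * (c * (p * q)) ≡ 2 * ((g * M + c) * (p * q))
  lem₃ = solve-∀

-- The threshold 11 minimises e / 2 + Σ_{i > e} i³ 2⁻ⁱ.
upper : ∀ {n d} {a : Coeffs n} m → ZeroOne a → DegreeAtMost a d → 11 ≤ d →
        1000 * suc m * numRelevant a ≤ (6614 * suc m + 1000) * 2 ^ d
upper {d = d} {a} m 01-valued deg 11≤d = subst (λ P → 1000 * suc m * numRelevant a ≤ (6614 * suc m + 1000) * P) pow
  -- `tailSum 11` is 2281, so K = 11 · 2048 + 2 · 2281 = 27090, and 2 · 6614 · 2048 = 27090944. Thus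
  -- K / 4096 is about 6.6138.
  (upper-arithmetic 1000 6614 (11 * 2 ^ 11 + 2 * tailSum 11) (2 ^ 11) (numRelevant a) (2 ^ t) (suc m) (ℕP.≤ᵇ⇒≤ 27090000 27090944 tt)
    (ℕP.≤-trans (relevant-bound 10 t {a = a} 01-valued (subst (DegreeAtMost a) (sym t+11) deg))
                (ℕP.≤-trans (ℕP.m≤m+n (ceiling 11 t) (2 * tailSum (t + 11))) (ℕP.≤-reflexive (ceiling-closed 11 t)))))
  where
  t = d ∸ 11
  t+11 : t + 11 ≡ d
  t+11 = ℕP.m∸n+n≡m 11≤d
  pow : 2 ^ t * 2 ^ 11 ≡ 2 ^ d
  pow = trans (sym (ℕP.^-distribˡ-+-* 2 t 11)) (cong (2 ^_) t+11)

-- For d = t + 1 the doubling example has 3 · 2^t - 2 variables, all relevant, and d ≥ m + 2 gives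
-- 2^t ≥ t ≥ m + 1.
lower : ∀ m d → suc (suc m) ≤ d → Σ ℕ (λ n → Σ (BoolFun n) (λ f → Σ (Coeffs n) (λ a →
        Represents f a × DegreeAtMost a d × ((3 * suc m ∸ 2) * 2 ^ d ≤ 2 * suc m * numRelevant a))))
lower m (suc t) (ℕ.s≤s m<t) with many-variables t
... | n , E , eq = n , proj₁ F , coeffs , proj₂ F , degree ,
  subst (λ r → (3 * suc m ∸ 2) * 2 ^ suc t ≤ 2 * suc m * r) (sym (numRelevant-all {a = coeffs} relevant))
    (lower-arithmetic m n (2 ^ t) (ℕP.≤-trans m<t (n≤2^n t)) eq)
  where
  open Example E
  F = function {a = coeffs} 01-valued

-- M = m + 1 stands for 1/ε: the limit is unfolded into the bounds 3/2 - 1/M and 6.614 + 1/M on R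
-- 2^(-d) for all large d, attained by some function in the first case and obeyed by every function
-- in the second.
theorem3p1 : ((m : ℕ) → Σ ℕ (λ D → (d : ℕ) → D ≤ d →
    Σ ℕ (λ n → Σ (BoolFun n) (λ f → Σ (Coeffs n) (λ a →
    Represents f a × DegreeAtMost a d ×
    ((3 * suc m ∸ 2) * 2 ^ d ≤ 2 * suc m * numRelevant a))))))
    ×
    ((m : ℕ) → Σ ℕ (λ D → (d : ℕ) → D ≤ d →
    (n : ℕ) (f : BoolFun n) (a : Coeffs n) →
    Represents f a → DegreeAtMost a d →
    1000 * suc m * numRelevant a ≤ (6614 * suc m + 1000) * 2 ^ d))
theorem3p1 = (λ m → suc (suc m) , lower m) ,
  λ m → 11 , λ d 11≤d n f a rep deg → upper {a = a} m (represents-ZeroOne {f = f} {a} rep) deg 11≤d
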